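{- Let $\psi:\mathcal{P}\to\mathrm{Qsym}[t_1,t_2,\dots][\alpha]$ be a linear map (homomorphism of abelian groups), and write $\psi(\alpha,t_1,t_2,\dots)(p)$ for $\psi(p)$. Suppose that 1. $\psi(\alpha,0,0,\dots)(P^n)=\alpha^n$ for every $n$-dimensional polytope $P^n$ (all $n\ge 0$); 2. $T\circ\psi=\psi\circ\Phi$ as maps $\mathcal{P}\to\mathrm{Qsym}[t,t_1,t_2,\dots][\alpha]$, where on $\mathcal{P}[t]$ the map $\psi$ is extended by $\psi(t)=t$; that is, for every $p\in\mathcal{P}$, $$\psi(\alpha,t,t_1,t_2,\dots)(p)=\sum_{k\geqslant 0}\psi(\alpha,t_1,t_2,\dots)(d_kp)\,t^k .$$ Then $\psi=f$.
   Context: A combinatorial polytope is a combinatorial equivalence class of convex polytopes. The ring of polytopes $\mathcal{P}$ is, as an abelian group, free on all (non-empty) combinatorial polytopes, with multiplication the direct product and unit the point. The operator $d_k$ sends an $n$-dimensional polytope to the sum of all its $(n-k)$-dimensional (non-empty) faces ($d_0=\mathrm{id}$), and $\Phi:\mathcal{P}\to\mathcal{P}[t]$ is $\Phi(t)=\sum_{k\ge0}d_kt^k$. For a composition $\omega=(j_1,\dots,j_k)$, $j_i\ge 1$, $M_\omega=\sum_{l_1<\dots<l_k}t_{l_1}^{j_1}\cdots t_{l_k}^{j_k}$; $\mathrm{Qsym}[t_1,t_2,\dots]$ is the ring of finite integer combinations of the $M_\omega$ (and constants). $T:\mathrm{Qsym}[t_1,t_2,\dots][\alpha]\to\mathrm{Qsym}[t,t_1,t_2,\dots][\alpha]$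 is the ring homomorphism $Tg(\alpha,t_1,t_2,\dots)=g(\alpha,t,t_1,t_2,\dots)$ (the ordered variables $t_1,t_2,t_3,\dots$ are replaced by $t,t_1,t_2,\dots$). The generalized $f$-polynomial $f:\mathcal{P}\to\mathrm{Qsym}[t_1,t_2,\dots][\alpha]$ is the linear map $$f(\alpha,t_1,t_2,\dots)(P^n)=\alpha^n+\sum_{k=1}^{n}\ \sum_{0\leqslant a_1<\dots<a_k\leqslant n-1}f_{a_1,\dots,a_k}\,\alpha^{a_1}M_{(n-a_k,\,a_k-a_{k-1},\dots,\,a_2-a_1)},$$ where $f_{a_1,\dots,a_k}$ is the number of chains of faces $F^{a_1}\subset\dots\subset F^{a_k}$ of $P^n$ with $\dim F^{a_i}=a_i$. -}

module Defs where

open import Level using (0ℓ)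
open import Algebra.Bundles using (AbelianGroup; CommutativeRing)
open import Algebra.Morphism.Structures using (module GroupMorphisms)
open import Axiom.ExcludedMiddle using (ExcludedMiddle)
open import Data.Bool.Base using (if_then_else_)
open import Data.Fin.Base using (Fin; toℕ)
open import Data.Fin.Properties using (toℕ<n)
open import Data.Fin.Subset
  using (Subset; inside; outside; _∈_; _∉_; _⊆_; ∣_∣; Nonempty)
open import Data.Fin.Subset.Properties using (_⊆?_)
open import Data.Integer.Base as ℤ using (ℤ; +_; 0ℤ; 1ℤ)
import Data.Integer.Properties as ℤₚ
open import Data.List.Base
  using (List; []; _∷_; _++_; map; concatMap; mapMaybe; filter; foldr; length;
         allFin; upTo; cartesianProductWith)
import Data.List.Properties as Listₚ
open import Data.List.Relation.Unary.All using (All; []; _∷_)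
open import Data.List.Relation.Unary.Linked using (Linked; linked?)
open import Data.Maybe.Base as Maybe using ()
open import Data.Nat.Base as ℕ using (ℕ; zero; suc; _∸_; _⊔_; pred; NonZero)
open import Data.Nat.Properties using (_≟_; nonZero?; m<n⇒0<n∸m)
open import Data.Product.Base using (Σ; ∃; ∃-syntax; _×_; _,_; proj₁; proj₂)
open import Data.Sum.Base using (_⊎_; inj₁; inj₂)
import Data.Vec.Base as Vec
open import Data.Vec.Functional using (Vector)
open import Function.Base using (_∘_; _on_)
open import Function.Bundles using (_⇔_)
open import Relation.Binary.Core using (Rel)
open import Relation.Binary.Definitions using (tri<; tri≈; tri>)
open import Relation.Binary.Morphism.Structures using (IsOrderIsomorphism)
open import Relation.Binary.PropositionalEquality
  using (_≡_; refl; sym; trans; cong; cong₂)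
open import Relation.Binary.Structures using (IsStrictTotalOrder)
open import Relation.Nullary.Decidable using (Dec; yes; no; ⌊_⌋; dec⇒maybe)
open import Relation.Nullary.Negation using (¬_; contradiction)

-- ℝ is the complete ordered field, unique up to isomorphism.

record CompleteOrderedField : Set₁ where
  infix 4 _<_
  field
    commutativeRing : CommutativeRing 0ℓ 0ℓ

  open CommutativeRing commutativeRing public

  field
    _<_                : Rel Carrier 0ℓ
    isStrictTotalOrder : IsStrictTotalOrder _≈_ _<_
    0<1                : 0# < 1#
    inverse            : ∀ x → ¬ (x ≈ 0#) → ∃[ y ] x * y ≈ 1#
    +-monoˡ-<          : ∀ {x y} z → x < y → x + z < y + z
    *-pos              : ∀ {x y} → 0# < x → 0# < y → 0# < x * y

  infix 4 _≤_
  _≤_ : Rel Carrier 0ℓ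
  x ≤ y = (x < y) ⊎ (x ≈ y)

  field
    supremum : (S : Carrier → Set) → ∃ S → (∃[ u ] ∀ x → S x → x ≤ u) →
               ∃[ s ] ((∀ x → S x → x ≤ s) ×
                       (∀ y → y < s → ∃[ x ] (S x × y < x)))

  open IsStrictTotalOrder isStrictTotalOrder public
    using (compare; irrefl; <-respʳ-≈; <-respˡ-≈) renaming (trans to <-trans)

-- Together, trichotomy and the existence of suprema are a classical
-- axiomatisation: compare 0 with the supremum of {0} ∪ {1 | P}.

module _ (ℝ : CompleteOrderedField) where
  open CompleteOrderedField ℝ renaming (refl to ≈-refl; sym to ≈-sym)

  excludedMiddle : ExcludedMiddle 0ℓ
  excludedMiddle {P} = decide
    where
    S : Carrier → Set
    S x = (x ≈ 0#) ⊎ ((x ≈ 1#) × P)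

    bounded : ∀ x → S x → x ≤ 1#
    bounded x (inj₁ x≈0)       = inj₁ (<-respˡ-≈ (≈-sym x≈0) 0<1)
    bounded x (inj₂ (x≈1 , _)) = inj₂ x≈1

    0<_ : ∀ {s} → 1# ≤ s → 0# < s
    0< inj₁ 1<s = <-trans 0<1 1<s
    0< inj₂ 1≈s = <-respʳ-≈ 1≈s 0<1

    decide : Dec P
    decide with supremum S (0# , inj₁ ≈-refl) (1# , bounded)
    ... | s , ub , approx with compare 0# s
    ...   | tri≈ 0≮s _ _ = no λ p → 0≮s (0< ub 1# (inj₂ (≈-refl , p)))
    ...   | tri> 0≮s _ _ = no λ p → 0≮s (0< ub 1# (inj₂ (≈-refl , p)))
    ...   | tri< 0<s _ _ with approx 0# 0<s
    ...     | x , inj₁ x≈0 , 0<x     = contradiction 0<x (irrefl (≈-sym x≈0))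
    ...     | x , inj₂ (_ , p) , 0<x = yes p

-- The free abelian group on the quotient of A by the equivalence
-- relation generated by _∼_.

module Free {A : Set} (_∼_ : Rel A 0ℓ) where

  infix  4 _≈_
  infixl 6 _⊕_

  data Term : Set where
    gen : A → Term
    𝟎   : Term
    _⊕_ : Term → Term → Term
    ⊖_  : Term → Term

  data _≈_ : Rel Term 0ℓ where
    gen-cong  : ∀ {x y} → x ∼ y → gen x ≈ gen y
    ≈-refl    : ∀ {p} → p ≈ p
    ≈-sym     : ∀ {p q} → p ≈ q → q ≈ p
    ≈-trans   : ∀ {p q r} → p ≈ q → q ≈ r → p ≈ r
    ⊕-cong    : ∀ {p p′ q q′} → p ≈ p′ → q ≈ q′ → p ⊕ q ≈ p′ ⊕ q′
    ⊖-cong    : ∀ {p q} → p ≈ q → ⊖ p ≈ ⊖ q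
    ⊕-assoc   : ∀ p q r → (p ⊕ q) ⊕ r ≈ p ⊕ (q ⊕ r)
    ⊕-comm    : ∀ p q → p ⊕ q ≈ q ⊕ p
    ⊕-identityˡ : ∀ p → 𝟎 ⊕ p ≈ p
    ⊕-inverseˡ  : ∀ p → ⊖ p ⊕ p ≈ 𝟎

  abelianGroup : AbelianGroup 0ℓ 0ℓ
  abelianGroup = record
    { Carrier = Term ; _≈_ = _≈_ ; _∙_ = _⊕_ ; ε = 𝟎 ; _⁻¹ = ⊖_
    ; isAbelianGroup = record
      { isGroup = record
        { isMonoid = record
          { isSemigroup = record
            { isMagma = record
              { isEquivalence = record { refl = ≈-refl ; sym = ≈-sym ; trans = ≈-trans }
              ; ∙-cong = ⊕-cong
              }
            ; assoc = ⊕-assoc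
            }
          ; identity = ⊕-identityˡ , λ p → ≈-trans (⊕-comm p 𝟎) (⊕-identityˡ p)
          }
        ; inverse = ⊕-inverseˡ , λ p → ≈-trans (⊕-comm p (⊖ p)) (⊕-inverseˡ p)
        ; ⁻¹-cong = ⊖-cong
        }
      ; comm = ⊕-comm
      }
    }

  extend : (G : AbelianGroup 0ℓ 0ℓ) → (A → AbelianGroup.Carrier G) →
           Term → AbelianGroup.Carrier G
  extend G h (gen x) = h x
  extend G h 𝟎       = AbelianGroup.ε G
  extend G h (p ⊕ q) = AbelianGroup._∙_ G (extend G h p) (extend G h q)
  extend G h (⊖ p)   = AbelianGroup._⁻¹ G (extend G h p)

  ⨁ : List Term → Term
  ⨁ = foldr _⊕_ 𝟎

-- The list e₁ ∷ … ∷ eₘ ∷ [] stands for the monomial t₁^e₁ ⋯ tₘ^eₘ.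

Exponents : Set
Exponents = List ℕ

Composition : Set
Composition = Σ (List ℕ) (All NonZero)

-- The coefficient of a monomial in M_ω = Σ_{l₁<…<lₖ} t_{l₁}^j₁ ⋯ t_{lₖ}^jₖ:
-- as the jᵢ are positive, a monomial arises from at most one sequence
-- l₁ < … < lₖ, namely the positions of its nonzero exponents.

M : Composition → Exponents → ℤ
M (ω , _) e = if ⌊ Listₚ.≡-dec _≟_ (filter nonZero? e) ω ⌋ then 1ℤ else 0ℤ

α^_ : ℕ → ℕ → ℤ
(α^ n) a = if ⌊ n ≟ a ⌋ then 1ℤ else 0ℤ

-- Coefficients of α^a t₁^e₁ t₂^e₂ ⋯ and of α^a t^j t₁^e₁ t₂^e₂ ⋯.

Series Seriesₜ : Set
Series  = ℕ → Exponents → ℤ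
Seriesₜ = ℕ → ℕ → Exponents → ℤ

-- An element of Qsym[t₁,t₂,…][α] is given as a finite sum of terms
-- c α^b M_ω; two elements are equal if they are equal as power series.

Qsym[α] : Set
Qsym[α] = List (ℤ × ℕ × Composition)

⟦_⟧ : Qsym[α] → Series
⟦ []              ⟧ a e = 0ℤ
⟦ (c , b , ω) ∷ g ⟧ a e = c ℤ.* ((α^ b) a ℤ.* M ω e) ℤ.+ ⟦ g ⟧ a e

infix 4 _≈Q_

_≈Q_ : Rel Qsym[α] 0ℓ
g ≈Q h = ∀ a e → ⟦ g ⟧ a e ≡ ⟦ h ⟧ a e

negate : Qsym[α] → Qsym[α]
negate = map λ (c , b , ω) → ℤ.- c , b , ω

⟦⟧-++ : ∀ g h a e → ⟦ g ++ h ⟧ a e ≡ ⟦ g ⟧ a e ℤ.+ ⟦ h ⟧ a e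
⟦⟧-++ []                h a e = sym (ℤₚ.+-identityˡ _)
⟦⟧-++ ((c , b , ω) ∷ g) h a e =
  trans (cong (λ z → c ℤ.* ((α^ b) a ℤ.* M ω e) ℤ.+ z) (⟦⟧-++ g h a e))
        (sym (ℤₚ.+-assoc (c ℤ.* ((α^ b) a ℤ.* M ω e)) _ _))

⟦⟧-negate : ∀ g a e → ⟦ negate g ⟧ a e ≡ ℤ.- ⟦ g ⟧ a e
⟦⟧-negate []                a e = refl
⟦⟧-negate ((c , b , ω) ∷ g) a e =
  trans (cong₂ ℤ._+_ (sym (ℤₚ.neg-distribˡ-* c ((α^ b) a ℤ.* M ω e))) (⟦⟧-negate g a e))
        (sym (ℤₚ.neg-distrib-+ (c ℤ.* ((α^ b) a ℤ.* M ω e)) _))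

Qsym[α]-abelianGroup : AbelianGroup 0ℓ 0ℓ
Qsym[α]-abelianGroup = record
  { Carrier = Qsym[α] ; _≈_ = _≈Q_ ; _∙_ = _++_ ; ε = [] ; _⁻¹ = negate
  ; isAbelianGroup = record
    { isGroup = record
      { isMonoid = record
        { isSemigroup = record
          { isMagma = record
            { isEquivalence = record
              { refl  = λ a e → refl
              ; sym   = λ p a e → sym (p a e)
              ; trans = λ p q a e → trans (p a e) (q a e)
              }
            ; ∙-cong = λ {g} {g′} {h} {h′} p q a e →
                trans (⟦⟧-++ g h a e)
                (trans (cong₂ ℤ._+_ (p a e) (q a e)) (sym (⟦⟧-++ g′ h′ a e)))
            }
          ; assoc = λ g h k a e → cong (λ l → ⟦ l ⟧ a e) (Listₚ.++-assoc g h k)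
          }
        ; identity = (λ g a e → refl)
                   , (λ g a e → cong (λ l → ⟦ l ⟧ a e) (Listₚ.++-identityʳ g))
        }
      ; inverse = inverseˡ
                , (λ g a e → trans (comm g (negate g) a e) (inverseˡ g a e))
      ; ⁻¹-cong = λ {g} {h} p a e →
          trans (⟦⟧-negate g a e) (trans (cong ℤ.-_ (p a e)) (sym (⟦⟧-negate h a e)))
      }
    ; comm = comm
    }
  }
  where
  comm : ∀ g h → g ++ h ≈Q h ++ g
  comm g h a e = trans (⟦⟧-++ g h a e)
    (trans (ℤₚ.+-comm (⟦ g ⟧ a e) (⟦ h ⟧ a e)) (sym (⟦⟧-++ h g a e)))

  inverseˡ : ∀ g → negate g ++ g ≈Q []
  inverseˡ g a e = trans (⟦⟧-++ (negate g) g a e)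
    (trans (cong (ℤ._+ ⟦ g ⟧ a e) (⟦⟧-negate g a e)) (ℤₚ.+-inverseˡ (⟦ g ⟧ a e)))

-- g(α,0,0,…), as its sequence of coefficients.

atZero : Qsym[α] → ℕ → ℤ
atZero g a = ⟦ g ⟧ a []

-- g(α,t,t₁,t₂,…)

T : Qsym[α] → Seriesₜ
T g a j e = ⟦ g ⟧ a (j ∷ e)

-- Σ_{k≥0} gₖ(α,t₁,t₂,…) t^k

Σₖ_t^k : (ℕ → Qsym[α]) → Seriesₜ
(Σₖ g t^k) a j e = ⟦ g j ⟧ a e

-- Strictly decreasing sequences n > aₖ > … > a₁ ≥ 0

data Descending (n : ℕ) : Set where
  []  : Descending n
  _∷_ : (a : Fin n) → Descending (toℕ a) → Descending n

descending : (k n : ℕ) → List (Descending n)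
descending zero    n = [] ∷ []
descending (suc k) n =
  concatMap (λ a → map (a ∷_) (descending k (toℕ a))) (allFin n)

lowest : ∀ {n} → Descending n → ℕ
lowest {n} []   = n
lowest (a ∷ as) = lowest as

-- (n - aₖ , aₖ - aₖ₋₁ , … , a₂ - a₁)

gaps : ∀ {n} → Descending n → Composition
gaps         []       = [] , []
gaps {n = n} (a ∷ as) =
  (n ∸ toℕ a) ∷ proj₁ (gaps as) , ℕ.>-nonZero (m<n⇒0<n∸m (toℕ<n a)) ∷ proj₂ (gaps as)

subsets : ∀ n → List (Subset n)
subsets zero    = Vec.[] ∷ []
subsets (suc n) = map (inside Vec.∷_) (subsets n) ++ map (outside Vec.∷_) (subsets n)

module Polytopes (ℝ : CompleteOrderedField) where

  open CompleteOrderedField ℝ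
    using (Carrier; _≈_; _<_; _≤_; _+_; _*_; 0#; 1#; +-rawMonoid)
  open import Algebra.Definitions.RawMonoid +-rawMonoid using (sum)

  Point : ℕ → Set
  Point m = Vector Carrier m

  _·_ : ∀ {m} → Point m → Point m → Carrier
  c · x = sum λ i → c i * x i

  -- The convex hull of { points i ∣ i ∈ support }. Allowing a support that
  -- is not everything means that faces, which are the hulls of smaller
  -- supports, need no reindexing.

  record Polytope : Set where
    field
      {ambient} : ℕ
      {size}    : ℕ
      points    : Fin size → Point ambient
      support   : Subset size
      nonempty  : Nonempty support

    combination : (Fin size → Carrier) → Point ambient
    combination w j = sum λ i → w i * points i j

    SupportedOn : Subset size → (Fin size → Carrier) → Set
    SupportedOn S w = ∀ i → i ∉ S → w i ≈ 0#

    _∈hull : Point ambient → Set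
    x ∈hull = ∃[ w ] (SupportedOn support w × (∀ i → 0# ≤ w i) × sum w ≈ 1# ×
                      (∀ j → combination w j ≈ x j))

    AffinelyIndependent : Subset size → Set
    AffinelyIndependent B =
      ∀ w → SupportedOn B w → sum w ≈ 0# → (∀ j → combination w j ≈ 0#) →
      ∀ i → w i ≈ 0#

    -- The affine hull is spanned by the generating points, so its dimension
    -- is one less than the largest number of affinely independent ones.

    dim : ℕ
    dim = pred (foldr _⊔_ 0 (map ∣_∣ (filter (λ B → excludedMiddle ℝ {P B}) (subsets size))))
      where
      P : Subset size → Set
      P B = B ⊆ support × AffinelyIndependent B

    -- F contains the generating points on a hyperplane c · x = b such that
    -- the polytope lies in the half-space c · x ≤ b. The face cut out by
    -- the hyperplane is the hull of these points. The improper faces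
    -- (everything, and ∅) arise from c = 0.

    IsFace : Subset size → Set
    IsFace F = ∃[ c ] ∃[ b ]
      ((∀ x → x ∈hull → c · x ≤ b) ×
       (∀ i → i ∈ F ⇔ (i ∈ support × c · points i ≈ b)))

    NonemptyFace : Set
    NonemptyFace = ∃[ F ] (IsFace F × Nonempty F)

    faces : List NonemptyFace
    faces = mapMaybe (λ F → Maybe.map (F ,_) (dec⇒maybe (excludedMiddle ℝ))) (subsets size)

    ⟨_⟩ : NonemptyFace → Polytope
    ⟨ F , _ , F≠∅ ⟩ = record { points = points ; support = F ; nonempty = F≠∅ }

  open Polytope using (dim; size; faces; IsFace; NonemptyFace; ⟨_⟩)

  -- Combinatorial equivalence: isomorphism of face lattices.

  _∼_ : Rel Polytope 0ℓ
  P ∼ Q = ∃[ φ ] IsOrderIsomorphism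
    {A = ∃ (IsFace P)} {B = ∃ (IsFace Q)}
    (_≡_ on proj₁) (_≡_ on proj₁) (_⊆_ on proj₁) (_⊆_ on proj₁) φ

  open Free _∼_ public using (Term; gen; extend; ⨁)

  𝒫 : AbelianGroup 0ℓ 0ℓ
  𝒫 = Free.abelianGroup _∼_

  facesOfDim : (P : Polytope) → ℕ → List (NonemptyFace P)
  facesOfDim P a = filter (λ F → dim (⟨_⟩ P F) ≟ a) (faces P)

  -- dim F + k ≡ dim P rather than dim F ≡ dim P ∸ k, so that d k P vanishes
  -- for k > dim P.

  d : ℕ → Term → Term
  d k = extend 𝒫 λ P →
    ⨁ (map (gen ∘ ⟨_⟩ P) (filter (λ F → dim (⟨_⟩ P F) ℕ.+ k ≟ dim P) (faces P)))

  -- Φ(p) = Σₖ dₖ(p) t^k, as its sequence of coefficients.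

  Φ : Term → (ℕ → Term)
  Φ p k = d k p

  -- The extension of ψ to 𝒫[t] by ψ(t) = t.

  _[t] : (Term → Qsym[α]) → (ℕ → Term) → Seriesₜ
  (ψ [t]) p = Σₖ (ψ ∘ p) t^k

  -- Chains Fᵃᵏ ⊇ … ⊇ Fᵃ¹ with dim Fᵃⁱ = aᵢ.

  tuples : ∀ (P : Polytope) {n} → Descending n → List (List (NonemptyFace P))
  tuples P []       = [] ∷ []
  tuples P (a ∷ as) = cartesianProductWith _∷_ (facesOfDim P (toℕ a)) (tuples P as)

  chains : ∀ (P : Polytope) {n} → Descending n → List (List (NonemptyFace P))
  chains P as = filter (linked? (λ F G → proj₁ G ⊆? proj₁ F)) (tuples P as)

  fPolynomial : Polytope → Qsym[α]
  fPolynomial P = (1ℤ , n , [] , []) ∷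
    concatMap (λ k → map (λ as → + length (chains P as) , lowest as , gaps as)
                         (descending k n))
              (map suc (upTo n))
    where n = dim P

  f : Term → Qsym[α]
  f = extend Qsym[α]-abelianGroup fPolynomial

  open GroupMorphisms (AbelianGroup.rawGroup 𝒫) (AbelianGroup.rawGroup Qsym[α]-abelianGroup)
    public using () renaming (IsGroupHomomorphism to IsLinear)

{-# OPTIONS --safe #-}
module Submission where

-- Condition 2 gives the coefficient of t₁^j t₂^e₁ t₃^e₂ ⋯ in ψ(p) as that of
-- t₁^e₁ t₂^e₂ ⋯ in ψ(dⱼ p), and condition 1 gives the coefficient of the
-- empty monomial, so at most one ψ satisfies both. It remains to see that f
-- does. For j > 0 the terms of f(P) that contribute to t₁^j ⋯ are the chains
-- whose largest member F has codimension j; the rest of such a chain is a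
-- chain of the polytope F, because the faces of F are the faces of P
-- contained in F. For j = 0 the variable t₁ does not occur, and d₀ P = P
-- because proper faces have smaller dimension.

open import Defs
open import Data.Bool.Base using (if_then_else_)
open import Data.Fin.Base using (Fin; zero; suc; toℕ; fromℕ<)
import Data.Fin.Properties as Finₚ
open import Data.Fin.Properties using (toℕ<n; toℕ-fromℕ<; toℕ-injective)
open import Data.Fin.Subset
  using (Subset; inside; outside; _∈_; _∉_; _⊆_; _⊂_; ∣_∣; Nonempty; _∪_; ⁅_⁆)
import Data.Fin.Subset.Properties as Subsetₚ
open import Data.Fin.Subset.Properties using (_⊆?_)
open import Data.Integer.Base as ℤ using (ℤ; +_; 0ℤ; 1ℤ)
import Data.Integer.Properties as ℤₚ
open import Data.Integer.Solver using (module +-*-Solver)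
open import Data.List.Base
  using (List; []; _∷_; _++_; map; concatMap; mapMaybe; filter; foldr; length;
         allFin; upTo; cartesianProductWith; applyUpTo)
import Data.List.Properties as Listₚ
open import Data.List.Membership.Propositional using () renaming (_∈_ to _∈ˡ_)
open import Data.List.Membership.Propositional.Properties
  using (∈-map⁺; ∈-map⁻; ∈-++⁺ˡ; ∈-++⁺ʳ; ∈-allFin; ∈-filter⁺; ∈-filter⁻)
open import Data.List.Relation.Unary.Any using (here; there)
import Data.List.Relation.Unary.All as All
open import Data.List.Relation.Unary.AllPairs using ([]; _∷_)
open import Data.List.Relation.Unary.Linked as Linked using (Linked; linked?; _∷_)
open import Data.List.Relation.Unary.Unique.Propositional using (Unique)
import Data.List.Relation.Unary.Unique.Propositional.Properties as Uniqueₚ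
open import Data.Maybe.Base as Maybe using (Maybe; just; nothing; maybe′)
open import Data.Nat.Base as ℕ using (ℕ; zero; suc; _∸_; _⊔_; s≤s; z≤n)
import Data.Nat.Properties as ℕₚ
open import Data.Nat.Properties using (_≟_)
open import Data.Product.Base using (∃; ∃-syntax; _×_; _,_; proj₁; proj₂)
open import Data.Sum.Base using (_⊎_; inj₁; inj₂; [_,_]′)
import Data.Vec.Base as Vec
import Data.Vec.Properties as Vecₚ
open import Function.Base using (_∘_; id; case_of_)
open import Function.Bundles using (mk⇔; Equivalence)
open import Relation.Binary.Definitions using (tri<; tri≈; tri>)
open import Relation.Binary.PropositionalEquality
  using (_≡_; _≢_; refl; sym; trans; cong; cong₂; subst; module ≡-Reasoning)
open import Relation.Nullary.Decidable using (Dec; yes; no; ⌊_⌋; does; dec⇒maybe)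
open import Relation.Nullary.Negation using (¬_; contradiction)
open import Relation.Unary using (Decidable)

-- Finite sums of integers

-- Removing the largest member F of a chain changes the ambient polytope from P to F, and most of
-- the bookkeeping comes from this. The faces of P and the faces of F form different types, with
-- witnesses from separate uses of `excludedMiddle`. But F keeps the points of P and only shrinks
-- the support, so both families are subsets of the same `Fin size`, and sums over faces can be
-- compared subset by subset. The sum defining f(P) runs over chain lengths up to dim P, so passing
-- to F would also change the range of lengths; `∑descending m n` therefore admits every length
-- bound m > n. The case j = 0 stands apart because the entries of a descending sequence lie
-- strictly below dim P: P itself is never a member of a counted chain.

private variable
  A B C : Set

𝟙 : Dec A → ℤ
𝟙 d = if ⌊ d ⌋ then 1ℤ else 0ℤ

𝟙-yes : (d : Dec A) → A → 𝟙 d ≡ 1ℤ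
𝟙-yes (yes _) _ = refl
𝟙-yes (no ¬a) a = contradiction a ¬a

𝟙-no : (d : Dec A) → ¬ A → 𝟙 d ≡ 0ℤ
𝟙-no (yes a) ¬a = contradiction a ¬a
𝟙-no (no _)  _  = refl

𝟙-× : (p : Dec A) (q : Dec B) (r : Dec C) →
      (A → B × C) → (B → C → A) → 𝟙 p ≡ 𝟙 q ℤ.* 𝟙 r
𝟙-× p (yes b) (yes c) to from = 𝟙-yes p (from b c)
𝟙-× p (yes b) (no ¬c) to from = 𝟙-no p (¬c ∘ proj₂ ∘ to)
𝟙-× p (no ¬b) r       to from =
  trans (𝟙-no p (¬b ∘ proj₁ ∘ to)) (sym (ℤₚ.*-zeroˡ (𝟙 r)))

-- Allows an identity valid only for faces of the right dimension to be applied inside a sum over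
-- all faces.
𝟙-*-cong : (d : Dec A) {x y : ℤ} → (A → x ≡ y) → 𝟙 d ℤ.* x ≡ 𝟙 d ℤ.* y
𝟙-*-cong (yes a)         eq = cong (1ℤ ℤ.*_) (eq a)
𝟙-*-cong (no _)  {x} {y} eq = trans (ℤₚ.*-zeroˡ x) (sym (ℤₚ.*-zeroˡ y))

∑ : List A → (A → ℤ) → ℤ
∑ []       h = 0ℤ
∑ (x ∷ xs) h = h x ℤ.+ ∑ xs h

∑-cong : ∀ (xs : List A) {h k} → (∀ x → h x ≡ k x) → ∑ xs h ≡ ∑ xs k
∑-cong []       eq = refl
∑-cong (x ∷ xs) eq = cong₂ ℤ._+_ (eq x) (∑-cong xs eq)

∑-zero : ∀ (xs : List A) {h} → (∀ x → h x ≡ 0ℤ) → ∑ xs h ≡ 0ℤ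
∑-zero []       eq = refl
∑-zero (x ∷ xs) eq = cong₂ ℤ._+_ (eq x) (∑-zero xs eq)

∑-++ : ∀ (xs ys : List A) h → ∑ (xs ++ ys) h ≡ ∑ xs h ℤ.+ ∑ ys h
∑-++ []       ys h = sym (ℤₚ.+-identityˡ _)
∑-++ (x ∷ xs) ys h =
  trans (cong (λ z → h x ℤ.+ z) (∑-++ xs ys h)) (sym (ℤₚ.+-assoc (h x) _ _))

∑-map : ∀ (g : A → B) xs h → ∑ (map g xs) h ≡ ∑ xs (h ∘ g)
∑-map g []       h = refl
∑-map g (x ∷ xs) h = cong (λ z → h (g x) ℤ.+ z) (∑-map g xs h)

∑-concatMap : ∀ (g : A → List B) xs h → ∑ (concatMap g xs) h ≡ ∑ xs (λ x → ∑ (g x) h)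
∑-concatMap g []       h = refl
∑-concatMap g (x ∷ xs) h =
  trans (∑-++ (g x) _ h) (cong (λ z → ∑ (g x) h ℤ.+ z) (∑-concatMap g xs h))

∑-cartesianProductWith : ∀ (g : A → B → C) xs ys h →
  ∑ (cartesianProductWith g xs ys) h ≡ ∑ xs (λ x → ∑ ys (λ y → h (g x y)))
∑-cartesianProductWith g []       ys h = refl
∑-cartesianProductWith g (x ∷ xs) ys h =
  trans (∑-++ (map (g x) ys) _ h)
        (cong₂ ℤ._+_ (∑-map (g x) ys h) (∑-cartesianProductWith g xs ys h))

∑-mapMaybe : ∀ (g : A → Maybe B) xs h →
             ∑ (mapMaybe g xs) h ≡ ∑ xs (λ x → maybe′ h 0ℤ (g x))
∑-mapMaybe g []       h = refl
∑-mapMaybe g (x ∷ xs) h with g x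
... | just y  = cong (λ z → h y ℤ.+ z) (∑-mapMaybe g xs h)
... | nothing = trans (∑-mapMaybe g xs h) (sym (ℤₚ.+-identityˡ _))

∑-filter : ∀ {P : A → Set} (P? : Decidable P) xs h →
           ∑ (filter P? xs) h ≡ ∑ xs (λ x → 𝟙 (P? x) ℤ.* h x)
∑-filter P? []       h = refl
∑-filter P? (x ∷ xs) h with P? x
... | yes _ = cong₂ ℤ._+_ (sym (ℤₚ.*-identityˡ (h x))) (∑-filter P? xs h)
... | no  _ = trans (sym (ℤₚ.+-identityˡ _)) (cong₂ ℤ._+_ (sym (ℤₚ.*-zeroˡ (h x))) (∑-filter P? xs h))

+length-filter : ∀ {P : A → Set} (P? : Decidable P) xs →
                 + length (filter P? xs) ≡ ∑ xs (λ x → 𝟙 (P? x))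
+length-filter P? []       = refl
+length-filter P? (x ∷ xs) with P? x
... | yes _ = cong (λ z → 1ℤ ℤ.+ z) (+length-filter P? xs)
... | no  _ = trans (+length-filter P? xs) (sym (ℤₚ.+-identityˡ _))

∑-distrib-+ : ∀ (xs : List A) h k → ∑ xs (λ x → h x ℤ.+ k x) ≡ ∑ xs h ℤ.+ ∑ xs k
∑-distrib-+ []       h k = refl
∑-distrib-+ (x ∷ xs) h k =
  trans (cong (λ z → h x ℤ.+ k x ℤ.+ z) (∑-distrib-+ xs h k))
        (solve 4 (λ a b c d → a :+ b :+ (c :+ d) := a :+ c :+ (b :+ d)) refl
           (h x) (k x) (∑ xs h) (∑ xs k))
  where open +-*-Solver

∑-comm : ∀ (xs : List A) (ys : List B) (h : A → B → ℤ) →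
         ∑ xs (λ x → ∑ ys (h x)) ≡ ∑ ys (λ y → ∑ xs (λ x → h x y))
∑-comm []       ys h = sym (∑-zero ys λ _ → refl)
∑-comm (x ∷ xs) ys h =
  trans (cong (λ z → ∑ ys (h x) ℤ.+ z) (∑-comm xs ys h)) (sym (∑-distrib-+ ys (h x) _))

*-distribˡ-∑ : ∀ c (xs : List A) h → c ℤ.* ∑ xs h ≡ ∑ xs (λ x → c ℤ.* h x)
*-distribˡ-∑ c []       h = ℤₚ.*-zeroʳ c
*-distribˡ-∑ c (x ∷ xs) h =
  trans (ℤₚ.*-distribˡ-+ c (h x) _) (cong (λ z → c ℤ.* h x ℤ.+ z) (*-distribˡ-∑ c xs h))

*-distribʳ-∑ : ∀ c (xs : List A) h → ∑ xs h ℤ.* c ≡ ∑ xs (λ x → h x ℤ.* c)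
*-distribʳ-∑ c xs h =
  trans (ℤₚ.*-comm (∑ xs h) c)
        (trans (*-distribˡ-∑ c xs h) (∑-cong xs λ x → ℤₚ.*-comm c (h x)))

∑-single : ∀ {xs : List A} {h x} → Unique xs → x ∈ˡ xs →
           (∀ y → y ≢ x → h y ≡ 0ℤ) → ∑ xs h ≡ h x
∑-single {h = h} {x} (x∉xs ∷ _) (here refl) vanish =
  trans (cong (λ z → h x ℤ.+ z) (zero-tail x∉xs)) (ℤₚ.+-identityʳ _)
  where
  zero-tail : ∀ {xs} → All.All (x ≢_) xs → ∑ xs h ≡ 0ℤ
  zero-tail All.[]         = refl
  zero-tail (x≢y All.∷ ps) = cong₂ ℤ._+_ (vanish _ (x≢y ∘ sym)) (zero-tail ps)
∑-single {h = h} {x} (y∉xs ∷ uniq) (there x∈xs) vanish =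
  trans (cong₂ ℤ._+_ (vanish _ (All.lookup y∉xs x∈xs)) (∑-single uniq x∈xs vanish))
        (ℤₚ.+-identityˡ _)

-- Sums over subsets and over descending sequences

∈-subsets : ∀ {n} (S : Subset n) → S ∈ˡ subsets n
∈-subsets Vec.[]              = here refl
∈-subsets (inside  Vec.∷ S) = ∈-++⁺ˡ (∈-map⁺ _ (∈-subsets S))
∈-subsets (outside Vec.∷ S) = ∈-++⁺ʳ _ (∈-map⁺ _ (∈-subsets S))

subsets-unique : ∀ n → Unique (subsets n)
subsets-unique zero    = All.[] ∷ []
subsets-unique (suc n) = Uniqueₚ.++⁺
  (Uniqueₚ.map⁺ Vecₚ.∷-injectiveʳ (subsets-unique n))
  (Uniqueₚ.map⁺ Vecₚ.∷-injectiveʳ (subsets-unique n))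
  λ (p , q) → disjoint (∈-map⁻ _ p) (∈-map⁻ _ q)
  where
  disjoint : ∀ {S : Subset (suc n)} →
    ∃ (λ U → U ∈ˡ subsets n × S ≡ inside Vec.∷ U) →
    ¬ ∃ (λ U → U ∈ˡ subsets n × S ≡ outside Vec.∷ U)
  disjoint (_ , _ , refl) (_ , _ , ())

-- The lengths are k < m. For m > n these are all the lengths that a descending sequence below n can
-- have, so this is then the sum over all such sequences.
∑descending : ∀ m n → (Descending n → ℤ) → ℤ
∑descending m n h = ∑ (upTo m) λ k → ∑ (descending k n) h

∑descending-suc : ∀ m n h → ∑descending (suc m) n h ≡
  h [] ℤ.+ ∑ (allFin n) λ x → ∑descending m (toℕ x) (h ∘ (x ∷_))
∑descending-suc m n h = cong₂ ℤ._+_ (ℤₚ.+-identityʳ (h [])) (begin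
  ∑ (applyUpTo suc m) (λ k → ∑ (descending k n) h)
    ≡⟨ cong (λ l → ∑ l λ k → ∑ (descending k n) h) (sym (Listₚ.map-upTo suc m)) ⟩
  ∑ (map suc (upTo m)) (λ k → ∑ (descending k n) h)
    ≡⟨ ∑-map suc (upTo m) _ ⟩
  ∑ (upTo m) (λ k → ∑ (descending (suc k) n) h)
    ≡⟨ ∑-cong (upTo m) (λ k → trans (∑-concatMap _ (allFin n) h)
                                    (∑-cong (allFin n) λ x → ∑-map (x ∷_) (descending k (toℕ x)) h)) ⟩
  ∑ (upTo m) (λ k → ∑ (allFin n) λ x → ∑ (descending k (toℕ x)) (h ∘ (x ∷_)))
    ≡⟨ ∑-comm (upTo m) (allFin n) _ ⟩
  ∑ (allFin n) (λ x → ∑descending m (toℕ x) (h ∘ (x ∷_))) ∎)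
  where open ≡-Reasoning

-- Splitting off the largest entry x lowers the length bounds by one and replaces n by x < n, so
-- both bounds stay large enough for the induction.
∑descending-stable : ∀ {m m′ n} h → n ℕ.< m → n ℕ.< m′ →
                     ∑descending m n h ≡ ∑descending m′ n h
∑descending-stable {suc m} {suc m′} {n} h (s≤s n≤m) (s≤s n≤m′) = begin
  ∑descending (suc m) n h
    ≡⟨ ∑descending-suc m n h ⟩
  h [] ℤ.+ (∑ (allFin n) λ x → ∑descending m (toℕ x) (h ∘ (x ∷_)))
    ≡⟨ cong (λ z → h [] ℤ.+ z) (∑-cong (allFin n) λ x →
         ∑descending-stable _ (ℕₚ.<-≤-trans (toℕ<n x) n≤m) (ℕₚ.<-≤-trans (toℕ<n x) n≤m′)) ⟩
  h [] ℤ.+ (∑ (allFin n) λ x → ∑descending m′ (toℕ x) (h ∘ (x ∷_)))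
    ≡⟨ ∑descending-suc m′ n h ⟨
  ∑descending (suc m′) n h ∎
  where open ≡-Reasoning

∑descending-cong : ∀ m n {h k} → (∀ as → h as ≡ k as) → ∑descending m n h ≡ ∑descending m n k
∑descending-cong m n eq = ∑-cong (upTo m) λ k → ∑-cong (descending k n) eq

*-distribˡ-∑descending : ∀ c m n h →
  c ℤ.* ∑descending m n h ≡ ∑descending m n (λ as → c ℤ.* h as)
*-distribˡ-∑descending c m n h =
  trans (*-distribˡ-∑ c (upTo m) _) (∑-cong (upTo m) λ k → *-distribˡ-∑ c (descending k n) h)

∑descending-∑ : ∀ m n (xs : List A) (h : A → Descending n → ℤ) →
  ∑descending m n (λ as → ∑ xs λ x → h x as) ≡ ∑ xs (λ x → ∑descending m n (h x))
∑descending-∑ m n xs h =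
  trans (∑-cong (upTo m) λ k → ∑-comm (descending k n) xs _) (∑-comm (upTo m) xs _)

-- The only candidate for x is m, and j > 0 guarantees that m = n - j lies below n. This merges the
-- condition on the first gap and the condition on the dimension of the largest face into the
-- condition used by `d`.
∑-𝟙-codimension : ∀ n j m → .{{ℕ.NonZero j}} →
  ∑ (allFin n) (λ x → 𝟙 (j ≟ n ∸ toℕ x) ℤ.* 𝟙 (m ≟ toℕ x)) ≡ 𝟙 (m ℕ.+ j ≟ n)
∑-𝟙-codimension n j@(suc _) m with m ℕ.+ j ≟ n
... | no m+j≢n = ∑-zero (allFin n) λ x →
  -- The refutation itself serves as the decision, so its indicator computes to 0.
  sym (𝟙-× (no (m+j≢n ∘ sum≡ x)) (j ≟ n ∸ toℕ x) (m ≟ toℕ x) id _,_)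
  where
  sum≡ : ∀ x → (j ≡ n ∸ toℕ x) × (m ≡ toℕ x) → m ℕ.+ j ≡ n
  sum≡ x (j≡ , m≡) = trans (cong₂ ℕ._+_ m≡ j≡) (ℕₚ.m+[n∸m]≡n (ℕₚ.<⇒≤ (toℕ<n x)))
... | yes refl = trans
  (∑-single {x = x₀} (Uniqueₚ.allFin⁺ n) (∈-allFin x₀) λ y y≢x₀ →
    trans (cong (𝟙 (j ≟ n ∸ toℕ y) ℤ.*_) (𝟙-no (m ≟ toℕ y)
            λ m≡y → y≢x₀ (toℕ-injective (trans (sym m≡y) (sym toℕx₀)))))
          (ℤₚ.*-zeroʳ (𝟙 (j ≟ n ∸ toℕ y))))
  (cong₂ ℤ._*_ (𝟙-yes (j ≟ n ∸ toℕ x₀) (sym (trans (cong (n ∸_) toℕx₀) (ℕₚ.m+n∸m≡n m j))))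
               (𝟙-yes (m ≟ toℕ x₀) (sym toℕx₀)))
  where
  m<n = ℕₚ.m<m+n m (s≤s z≤n)
  x₀ = fromℕ< m<n
  toℕx₀ = toℕ-fromℕ< m<n

-- Coefficients of quasisymmetric functions; maxima of lists

coefficient : ℕ → Exponents → ℤ × ℕ × Composition → ℤ
coefficient a e (c , b , ω) = c ℤ.* ((α^ b) a ℤ.* M ω e)

⟦⟧≡∑ : ∀ g a e → ⟦ g ⟧ a e ≡ ∑ g (coefficient a e)
⟦⟧≡∑ []      a e = refl
⟦⟧≡∑ (t ∷ g) a e = cong (λ z → coefficient a e t ℤ.+ z) (⟦⟧≡∑ g a e)

-- A positive first exponent survives the filter in `M`, so it has to match the first part of the
-- composition.
M-suc-∷ : ∀ {x ω p p′} j e → M (x ∷ ω , p) (suc j ∷ e) ≡ 𝟙 (suc j ≟ x) ℤ.* M (ω , p′) e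
M-suc-∷ {x} {ω} j e = 𝟙-×
  (Listₚ.≡-dec _≟_ (filter ℕₚ.nonZero? (suc j ∷ e)) (x ∷ ω)) (suc j ≟ x)
  (Listₚ.≡-dec _≟_ (filter ℕₚ.nonZero? e) ω) Listₚ.∷-injective (cong₂ _∷_)

maximum≥ : ∀ (g : A → ℕ) {xs x} → x ∈ˡ xs → g x ℕ.≤ foldr _⊔_ 0 (map g xs)
maximum≥ g (here refl) = ℕₚ.m≤m⊔n _ _
maximum≥ g (there x∈)  = ℕₚ.≤-trans (maximum≥ g x∈) (ℕₚ.m≤n⊔m _ _)

maximum-attained : ∀ (g : A → ℕ) {xs x} → x ∈ˡ xs →
                   ∃[ y ] (y ∈ˡ xs × g y ≡ foldr _⊔_ 0 (map g xs))
maximum-attained g {z ∷ []}     (here refl) = z , here refl , sym (ℕₚ.⊔-identityʳ (g z))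
maximum-attained g {z ∷ y ∷ xs} _
  with ℕₚ.⊔-sel (g z) (foldr _⊔_ 0 (map g (y ∷ xs))) | maximum-attained g {y ∷ xs} (here refl)
... | inj₁ eq | _              = z , here refl , sym eq
... | inj₂ eq | w , w∈ , eq′ = w , there w∈ , trans eq′ (sym eq)

-- Faces and dimension

module OrderedField (ℝ : CompleteOrderedField) where
  open CompleteOrderedField ℝ hiding (zero)
    renaming (refl to ≈-refl; sym to ≈-sym; trans to ≈-trans)
  open import Algebra.Properties.Semiring.Sum semiring public
    using (sum; sum-cong-≋; sum-replicate-zero; *-distribˡ-sum; *-distribʳ-sum)
    renaming (∑-distrib-+ to sum-distrib-+; ∑-comm to sum-comm)
  open import Relation.Binary.Reasoning.Setoid setoid

  ≤-reflexive : ∀ {x y} → x ≈ y → x ≤ y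
  ≤-reflexive = inj₂

  ≤-trans : ∀ {x y z} → x ≤ y → y ≤ z → x ≤ z
  ≤-trans (inj₁ x<y) (inj₁ y<z) = inj₁ (<-trans x<y y<z)
  ≤-trans (inj₁ x<y) (inj₂ y≈z) = inj₁ (<-respʳ-≈ y≈z x<y)
  ≤-trans (inj₂ x≈y) (inj₁ y<z) = inj₁ (<-respˡ-≈ (≈-sym x≈y) y<z)
  ≤-trans (inj₂ x≈y) (inj₂ y≈z) = inj₂ (≈-trans x≈y y≈z)

  <-≤-trans : ∀ {x y z} → x < y → y ≤ z → x < z
  <-≤-trans x<y (inj₁ y<z) = <-trans x<y y<z
  <-≤-trans x<y (inj₂ y≈z) = <-respʳ-≈ y≈z x<y

  ≤-total : ∀ x y → x ≤ y ⊎ y ≤ x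
  ≤-total x y with compare x y
  ... | tri< x<y _ _ = inj₁ (inj₁ x<y)
  ... | tri≈ _ x≈y _ = inj₁ (inj₂ x≈y)
  ... | tri> _ _ y<x = inj₂ (inj₁ y<x)

  +-monoʳ-< : ∀ {x y} z → x < y → z + x < z + y
  +-monoʳ-< z x<y = <-respʳ-≈ (+-comm _ z) (<-respˡ-≈ (+-comm _ z) (+-monoˡ-< z x<y))

  +-monoʳ-≤ : ∀ {x y} z → x ≤ y → z + x ≤ z + y
  +-monoʳ-≤ z (inj₁ x<y) = inj₁ (+-monoʳ-< z x<y)
  +-monoʳ-≤ z (inj₂ x≈y) = inj₂ (+-congˡ x≈y)

  +-mono-≤ : ∀ {x y u v} → x ≤ y → u ≤ v → x + u ≤ y + v
  +-mono-≤ {x} {y} {u} {v} x≤y u≤v =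
    ≤-trans (+-monoʳ-≤ x u≤v)
            (≤-trans (≤-reflexive (+-comm x v))
                     (≤-trans (+-monoʳ-≤ v x≤y) (≤-reflexive (+-comm v y))))

  x+[y-x]≈y : ∀ x y → x + (y - x) ≈ y
  x+[y-x]≈y x y = begin
    x + (y - x)   ≈⟨ +-comm x (y - x) ⟩
    y - x + x     ≈⟨ +-assoc y (- x) x ⟩
    y + (- x + x) ≈⟨ +-congˡ (-‿inverseˡ x) ⟩
    y + 0#        ≈⟨ +-identityʳ y ⟩
    y             ∎

  x<y⇒0<y-x : ∀ {x y} → x < y → 0# < y - x
  x<y⇒0<y-x {x} x<y = <-respˡ-≈ (-‿inverseʳ x) (+-monoˡ-< (- x) x<y)

  -- `z * y` exceeds `z * x` by the positive product `z * (y - x)`.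
  *-monoˡ-< : ∀ {x y z} → 0# < z → x < y → z * x < z * y
  *-monoˡ-< {x} {y} {z} 0<z x<y =
    <-respʳ-≈ (≈-trans (≈-sym (distribˡ z x (y - x))) (*-congˡ (x+[y-x]≈y x y)))
      (<-respˡ-≈ (+-identityʳ (z * x)) (+-monoʳ-< (z * x) (*-pos 0<z (x<y⇒0<y-x x<y))))

  *-monoˡ-≤ : ∀ {x y z} → 0# ≤ z → x ≤ y → z * x ≤ z * y
  *-monoˡ-≤ {z = z} (inj₁ 0<z) (inj₁ x<y) = inj₁ (*-monoˡ-< 0<z x<y)
  *-monoˡ-≤         (inj₂ 0≈z) (inj₁ _)   =
    inj₂ (≈-trans (*-congʳ (≈-sym 0≈z)) (≈-trans (zeroˡ _) (≈-trans (≈-sym (zeroˡ _)) (*-congʳ 0≈z))))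
  *-monoˡ-≤         _          (inj₂ x≈y) = inj₂ (*-congˡ x≈y)

  x*y≈0⇒x≈0 : ∀ {x y} → ¬ (y ≈ 0#) → x * y ≈ 0# → x ≈ 0#
  x*y≈0⇒x≈0 {x} {y} y≉0 xy≈0 with inverse y y≉0
  ... | z , yz≈1 = begin
    x           ≈⟨ *-identityʳ x ⟨
    x * 1#      ≈⟨ *-congˡ yz≈1 ⟨
    x * (y * z) ≈⟨ *-assoc x y z ⟨
    x * y * z   ≈⟨ *-congʳ xy≈0 ⟩
    0# * z      ≈⟨ zeroˡ z ⟩
    0#          ∎

  sum-zero : ∀ {n} {v : Fin n → Carrier} → (∀ i → v i ≈ 0#) → sum v ≈ 0#
  sum-zero {n} v≈0 = ≈-trans (sum-cong-≋ v≈0) (sum-replicate-zero n)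

  sum-single : ∀ {n} (v : Fin n → Carrier) i → (∀ k → k ≢ i → v k ≈ 0#) → sum v ≈ v i
  sum-single {suc n} v zero    vanish =
    ≈-trans (+-congˡ (sum-zero λ k → vanish (suc k) λ ())) (+-identityʳ (v zero))
  sum-single {suc n} v (suc i) vanish =
    ≈-trans (+-congʳ (vanish zero λ ()))
          (≈-trans (+-identityˡ _)
                 (sum-single (v ∘ suc) i λ k k≢i → vanish (suc k) (k≢i ∘ Finₚ.suc-injective)))

  sum-mono-≤ : ∀ {n} {u v : Fin n → Carrier} → (∀ i → u i ≤ v i) → sum u ≤ sum v
  sum-mono-≤ {zero}  u≤v = ≤-reflexive ≈-refl
  sum-mono-≤ {suc n} u≤v = +-mono-≤ (u≤v zero) (sum-mono-≤ (u≤v ∘ suc))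

  δ : ∀ {n} → Fin n → Fin n → Carrier
  δ i k = if does (k Finₚ.≟ i) then 1# else 0#

  δ-diagonal : ∀ {n} (i : Fin n) → δ i i ≈ 1#
  δ-diagonal i with i Finₚ.≟ i
  ... | yes _  = ≈-refl
  ... | no i≢i = contradiction refl i≢i

  δ-off-diagonal : ∀ {n} {i k : Fin n} → k ≢ i → δ i k ≈ 0#
  δ-off-diagonal {i = i} {k} k≢i with k Finₚ.≟ i
  ... | yes k≡i = contradiction k≡i k≢i
  ... | no  _   = ≈-refl

  0≤δ : ∀ {n} (i k : Fin n) → 0# ≤ δ i k
  0≤δ i k with k Finₚ.≟ i
  ... | yes _ = inj₁ 0<1
  ... | no  _ = inj₂ ≈-refl

  sum-δ-* : ∀ {n} (i : Fin n) (v : Fin n → Carrier) → sum (λ k → δ i k * v k) ≈ v i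
  sum-δ-* i v = ≈-trans
    (sum-single _ i λ k k≢i → ≈-trans (*-congʳ (δ-off-diagonal k≢i)) (zeroˡ (v k)))
    (≈-trans (*-congʳ (δ-diagonal i)) (*-identityˡ (v i)))

  -- For positive y take t = (x + 1) / y, so that t y = x + 1. Otherwise the condition is vacuous
  -- and 0 is a default.
  scaling : ∀ x y → ∃[ t ] (0# < y → x < t * y)
  scaling x y with compare 0# y
  ... | tri≈ 0≮y _ _ = 0# , λ 0<y → contradiction 0<y 0≮y
  ... | tri> 0≮y _ _ = 0# , λ 0<y → contradiction 0<y 0≮y
  ... | tri< 0<y _ _ with inverse y (λ y≈0 → irrefl (≈-sym y≈0) 0<y)
  ...   | z , yz≈1 = (x + 1#) * z , λ _ → <-respʳ-≈ (≈-sym (begin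
      (x + 1#) * z * y   ≈⟨ *-assoc (x + 1#) z y ⟩
      (x + 1#) * (z * y) ≈⟨ *-congˡ (≈-trans (*-comm z y) yz≈1) ⟩
      (x + 1#) * 1#      ≈⟨ *-identityʳ (x + 1#) ⟩
      x + 1#             ∎))
    (<-respˡ-≈ (+-identityʳ x) (+-monoʳ-< x 0<1))

  -- The maximum of the individual factors works, since enlarging t only increases t v for positive
  -- v. This provides the large t in `face-of-face⇒face`.
  scaling-uniform : ∀ {n} (u v : Fin n → Carrier) → ∃[ t ] (∀ i → 0# < v i → u i < t * v i)
  scaling-uniform {zero}  u v = 0# , λ ()
  scaling-uniform {suc n} u v with scaling (u zero) (v zero) | scaling-uniform (u ∘ suc) (v ∘ suc)
  ... | s , s-scales | t , t-scales = max , λ where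
      zero    0<v → <-≤-trans (s-scales 0<v) (*-monoʳ-≤ 0<v s≤max)
      (suc i) 0<v → <-≤-trans (t-scales i 0<v) (*-monoʳ-≤ 0<v t≤max)
    where
    *-monoʳ-≤ : ∀ {x y z} → 0# < z → x ≤ y → x * z ≤ y * z
    *-monoʳ-≤ 0<z x≤y =
      ≤-trans (≤-reflexive (*-comm _ _))
              (≤-trans (*-monoˡ-≤ (inj₁ 0<z) x≤y) (≤-reflexive (*-comm _ _)))
    upper : ∃[ m ] (s ≤ m × t ≤ m)
    upper = [ (λ s≤t → t , s≤t , ≤-reflexive ≈-refl) , (λ t≤s → s , ≤-reflexive ≈-refl , t≤s) ]′ (≤-total s t)
    max = proj₁ upper
    s≤max = proj₁ (proj₂ upper)
    t≤max = proj₂ (proj₂ upper)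

-- Hulls, faces of faces, affine independence

module Geometry (ℝ : CompleteOrderedField) where
  open CompleteOrderedField ℝ hiding (zero)
    renaming (refl to ≈-refl; sym to ≈-sym; trans to ≈-trans)
  open OrderedField ℝ
  open import Algebra.Properties.Ring ring using (+-cancelˡ; x∙y⁻¹≈ε⇒x≈y)
  open Polytopes ℝ using (Polytope; Point; _·_)
  open import Relation.Binary.Reasoning.Setoid setoid

  ·-combination : ∀ {m n} (c : Point m) (w : Fin n → Carrier) (p : Fin n → Point m) →
                  c · (λ j → sum λ i → w i * p i j) ≈ sum λ i → w i * (c · p i)
  ·-combination c w p = begin
    sum (λ j → c j * sum (λ i → w i * p i j))
      ≈⟨ sum-cong-≋ (λ j → ≈-trans (*-distribˡ-sum (c j) (λ i → w i * p i j))
           (sum-cong-≋ λ i → ≈-trans (≈-sym (*-assoc (c j) (w i) (p i j)))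
             (≈-trans (*-congʳ (*-comm (c j) (w i))) (*-assoc (w i) (c j) (p i j))))) ⟩
    sum (λ j → sum λ i → w i * (c j * p i j))
      ≈⟨ sum-comm (λ j i → w i * (c j * p i j)) ⟩
    sum (λ i → sum λ j → w i * (c j * p i j))
      ≈⟨ sum-cong-≋ (λ i → ≈-sym (*-distribˡ-sum (w i) (λ j → c j * p i j))) ⟩
    sum (λ i → w i * (c · p i)) ∎

  ·-congʳ : ∀ {m} (c : Point m) {x y} → (∀ j → x j ≈ y j) → c · x ≈ c · y
  ·-congʳ c x≈y = sum-cong-≋ λ j → *-congˡ (x≈y j)

  ·-linearˡ : ∀ {m} t (c c′ : Point m) x → (λ j → t * c j + c′ j) · x ≈ t * (c · x) + c′ · x
  ·-linearˡ t c c′ x = begin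
    sum (λ j → (t * c j + c′ j) * x j)
      ≈⟨ sum-cong-≋ (λ j → ≈-trans (distribʳ (x j) (t * c j) (c′ j)) (+-congʳ (*-assoc t (c j) (x j)))) ⟩
    sum (λ j → t * (c j * x j) + c′ j * x j)
      ≈⟨ sum-distrib-+ (λ j → t * (c j * x j)) (λ j → c′ j * x j) ⟩
    sum (λ j → t * (c j * x j)) + c′ · x
      ≈⟨ +-congʳ (≈-sym (*-distribˡ-sum t (λ j → c j * x j))) ⟩
    t * (c · x) + c′ · x ∎

  module _ (P : Polytope) where
    open Polytope P

    point∈hull : ∀ {i} → i ∈ support → points i ∈hull
    point∈hull {i} i∈ = δ i , (λ k k∉ → δ-off-diagonal {i = i} {k} λ { refl → k∉ i∈ }) , 0≤δ i ,
      ≈-trans (sum-cong-≋ λ k → ≈-sym (*-identityʳ (δ i k))) (sum-δ-* i (λ _ → 1#)) ,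
      λ j → sum-δ-* i (λ k → points k j)

    -- At a convex combination, c takes the weighted mean of its values at the generating points.
    -- Points off the support may violate the bound, but their weights vanish.
    halfspace⊇hull : ∀ c b → (∀ i → i ∈ support → c · points i ≤ b) →
                     ∀ x → x ∈hull → c · x ≤ b
    halfspace⊇hull c b below x (w , w-support , 0≤w , sum-w , w-x) =
      ≤-trans (≤-reflexive (≈-trans (·-congʳ c (≈-sym ∘ w-x)) (·-combination c w points)))
        (≤-trans (sum-mono-≤ termwise) (≤-reflexive (begin
          sum (λ i → w i * b) ≈⟨ *-distribʳ-sum b w ⟨
          sum w * b           ≈⟨ *-congʳ sum-w ⟩
          1# * b              ≈⟨ *-identityˡ b ⟩
          b                   ∎)))
      where
      termwise : ∀ i → w i * (c · points i) ≤ w i * b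
      termwise i with i Subsetₚ.∈? support
      ... | yes i∈ = *-monoˡ-≤ (0≤w i) (below i i∈)
      ... | no  i∉ = ≤-reflexive
        (≈-trans (*-congʳ (w-support i i∉)) (≈-trans (zeroˡ _) (≈-sym (≈-trans (*-congʳ (w-support i i∉)) (zeroˡ b)))))

  module _ (P : Polytope) where
    open Polytope P

    IsFace⇒⊆ : ∀ {F} → IsFace F → F ⊆ support
    IsFace⇒⊆ (_ , _ , _ , F⇔) i∈F = proj₁ (Equivalence.to (F⇔ _) i∈F)

    support-isFace : IsFace support
    support-isFace = (λ _ → 0#) , 0# , (λ x _ → ≤-reflexive (0·≈0 x)) ,
      λ i → mk⇔ (λ i∈ → i∈ , 0·≈0 (points i)) proj₁
      where
      0·≈0 : ∀ x → (λ _ → 0#) · x ≈ 0#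
      0·≈0 x = sum-zero λ j → zeroˡ (x j)

    -- The same hyperplane works: weights supported on F are supported on `support`, so the hull of
    -- F lies in the hull of P.
    face-within⇒face-of-face : (F : NonemptyFace) → ∀ {G} → IsFace G → G ⊆ proj₁ F →
                               Polytope.IsFace ⟨ F ⟩ G
    face-within⇒face-of-face (F , F-face , _) (c , b , below , G⇔) G⊆F =
      c , b ,
      (λ x (w , w-support , rest) → below x (w , (λ i i∉ → w-support i (i∉ ∘ IsFace⇒⊆ F-face)) , rest)) ,
      λ i → mk⇔ (λ i∈G → G⊆F i∈G , proj₂ (Equivalence.to (G⇔ i) i∈G))
                (λ (i∈F , eq) → Equivalence.from (G⇔ i) (IsFace⇒⊆ F-face i∈F , eq))

    -- If F and G are cut out by the functionals c and c′, then G is cut out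
    -- in P by t c + c′ for all large t.
    face-of-face⇒face : (F : NonemptyFace) → ∀ {G} → Polytope.IsFace ⟨ F ⟩ G → IsFace G
    face-of-face⇒face Fₙ@(F , F-face@(c , b , below , F⇔) , _) {G} (c′ , b′ , below′ , G⇔) =
      c″ , b″ , halfspace⊇hull P c″ b″ c″≤b″ , λ i → mk⇔ to (from i)
      where
      -- Off F the slack b - c·p is positive, and t (b - c·p) > c′·p - b′ is a rearrangement of c″·p
      -- < b″.
      scale = scaling-uniform (λ i → c′ · points i - b′) (λ i → b - c · points i)
      t = proj₁ scale
      c″ : Point ambient
      c″ j = t * c j + c′ j
      b″ = t * b + b′

      G⊆F : G ⊆ F
      G⊆F i∈G = proj₁ (Equivalence.to (G⇔ _) i∈G)

      on-F : ∀ {i} → i ∈ F → c″ · points i ≈ t * b + c′ · points i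
      on-F {i} i∈F = ≈-trans (·-linearˡ t c c′ (points i))
        (+-congʳ (*-congˡ (proj₂ (Equivalence.to (F⇔ i) i∈F))))

      off-F : ∀ {i} → i ∈ support → i ∉ F → c″ · points i < b″
      off-F {i} i∈ i∉F = <-respˡ-≈ (≈-sym (·-linearˡ t c c′ (points i))) (strict cp<b)
        where
        cp = c · points i
        c′p = c′ · points i
        cp<b : cp < b
        cp<b = [ id , (λ eq → contradiction (Equivalence.from (F⇔ i) (i∈ , eq)) i∉F) ]′
                 (below (points i) (point∈hull P i∈))
        strict : cp < b → t * cp + c′p < b″
        strict lt = <-respʳ-≈ rhs (<-respˡ-≈ lhs
          (+-monoʳ-< (t * cp + b′) (proj₂ scale i (x<y⇒0<y-x lt))))
          where
          lhs : t * cp + b′ + (c′p - b′) ≈ t * cp + c′p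
          lhs = ≈-trans (+-assoc _ _ _) (+-congˡ (x+[y-x]≈y b′ c′p))
          rhs : t * cp + b′ + t * (b - cp) ≈ b″
          rhs = begin
            t * cp + b′ + t * (b - cp)   ≈⟨ +-assoc _ _ _ ⟩
            t * cp + (b′ + t * (b - cp)) ≈⟨ +-congˡ (+-comm _ _) ⟩
            t * cp + (t * (b - cp) + b′) ≈⟨ +-assoc _ _ _ ⟨
            t * cp + t * (b - cp) + b′   ≈⟨ +-congʳ (distribˡ t cp (b - cp)) ⟨
            t * (cp + (b - cp)) + b′     ≈⟨ +-congʳ (*-congˡ (x+[y-x]≈y cp b)) ⟩
            b″                           ∎

      c″≤b″ : ∀ i → i ∈ support → c″ · points i ≤ b″
      c″≤b″ i i∈ with i Subsetₚ.∈? F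
      ... | yes i∈F = ≤-trans (≤-reflexive (on-F i∈F))
        (+-monoʳ-≤ (t * b) (below′ (points i) (point∈hull ⟨ Fₙ ⟩ i∈F)))
      ... | no i∉F = inj₁ (off-F i∈ i∉F)

      to : ∀ {i} → i ∈ G → i ∈ support × c″ · points i ≈ b″
      to i∈G = IsFace⇒⊆ F-face (G⊆F i∈G) ,
        ≈-trans (on-F (G⊆F i∈G)) (+-congˡ (proj₂ (Equivalence.to (G⇔ _) i∈G)))

      from : ∀ i → i ∈ support × c″ · points i ≈ b″ → i ∈ G
      from i (i∈ , eq) with i Subsetₚ.∈? F
      -- A point on the new hyperplane must lie in F, as the bound is strict elsewhere; on F the
      -- summand t b cancels and leaves the equation of G.
      ... | no i∉F  = contradiction (off-F i∈ i∉F) (irrefl eq)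
      ... | yes i∈F = Equivalence.from (G⇔ i) (i∈F , +-cancelˡ (t * b) _ _ (≈-trans (≈-sym (on-F i∈F)) eq))

    -- The sum of the weights, which is 0, is the single weight at i.
    ⁅⁆-affinelyIndependent : ∀ i → AffinelyIndependent ⁅ i ⁆
    ⁅⁆-affinelyIndependent i w w-support sum-w _ k with k Finₚ.≟ i
    ... | no k≢i     = w-support k (k≢i ∘ Subsetₚ.x∈⁅y⁆⇒x≡y i)
    ... | yes refl = ≈-trans (≈-sym (sum-single w i λ l l≢i → w-support l (l≢i ∘ Subsetₚ.x∈⁅y⁆⇒x≡y i))) sum-w

    -- Pairing an affine relation with the functional that cuts out F leaves
    -- only the term at i.
    adjoin-affinelyIndependent : ∀ {F B i} → IsFace F → B ⊆ F → i ∈ support → i ∉ F →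
      AffinelyIndependent B → AffinelyIndependent (B ∪ ⁅ i ⁆)
    adjoin-affinelyIndependent {F} {B} {i} (c , b , _ , F⇔) B⊆F i∈ i∉F indep w w-support sum-w w-zero =
      indep w w-supportB sum-w w-zero
      where
      height : Fin size → Carrier
      height k = c · points k - b

      outside-i : ∀ {k} → k ∉ B → k ≢ i → w k ≈ 0#
      outside-i k∉B k≢i = w-support _ ([ k∉B , k≢i ∘ Subsetₚ.x∈⁅y⁆⇒x≡y i ]′ ∘ Subsetₚ.x∈p∪q⁻ B ⁅ i ⁆)

      vanish : ∀ k → k ≢ i → w k * height k ≈ 0#
      vanish k k≢i with k Subsetₚ.∈? B
      ... | yes k∈B = ≈-trans (*-congˡ (≈-trans (+-congʳ (proj₂ (Equivalence.to (F⇔ k) (B⊆F k∈B)))) (-‿inverseʳ b)))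
                            (zeroʳ (w k))
      ... | no  k∉B = ≈-trans (*-congʳ (outside-i k∉B k≢i)) (zeroˡ (height k))

      sum-height : sum (λ k → w k * height k) ≈ 0#
      sum-height = begin
        sum (λ k → w k * height k)
          ≈⟨ sum-cong-≋ (λ k → distribˡ (w k) (c · points k) (- b)) ⟩
        sum (λ k → w k * (c · points k) + w k * - b)
          ≈⟨ sum-distrib-+ (λ k → w k * (c · points k)) (λ k → w k * - b) ⟩
        sum (λ k → w k * (c · points k)) + sum (λ k → w k * - b)
          ≈⟨ +-cong (≈-sym (·-combination c w points)) (≈-sym (*-distribʳ-sum (- b) w)) ⟩
        c · combination w + sum w * - b
          ≈⟨ +-cong (sum-zero λ j → ≈-trans (*-congˡ (w-zero j)) (zeroʳ (c j)))
                    (≈-trans (*-congʳ sum-w) (zeroˡ (- b))) ⟩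
        0# + 0#
          ≈⟨ +-identityˡ 0# ⟩
        0# ∎

      wi≈0 : w i ≈ 0#
      -- The height of i is nonzero because a generating point of height 0 would belong to F.
      wi≈0 = x*y≈0⇒x≈0 (λ eq → i∉F (Equivalence.from (F⇔ i) (i∈ , x∙y⁻¹≈ε⇒x≈y _ _ eq)))
        (≈-trans (≈-sym (sum-single _ i vanish)) sum-height)

      w-supportB : SupportedOn B w
      w-supportB k k∉B with k Finₚ.≟ i
      ... | yes refl = wi≈0
      ... | no k≢i     = outside-i k∉B k≢i

  module _ (P : Polytope) where
    open Polytope P

    -- The list whose largest cardinality enters `dim`; it agrees by computation with the one
    -- written there.
    independentSets : List (Subset size)
    independentSets =
      filter (λ B → excludedMiddle ℝ {B ⊆ support × AffinelyIndependent B}) (subsets size)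

    ∈-independentSets⁺ : ∀ {B} → B ⊆ support → AffinelyIndependent B → B ∈ˡ independentSets
    ∈-independentSets⁺ B⊆ indep =
      ∈-filter⁺ (λ B → excludedMiddle ℝ {B ⊆ support × AffinelyIndependent B})
                (∈-subsets _) ((λ {x} → B⊆ {x}) , indep)

    ∈-independentSets⁻ : ∀ {B} → B ∈ˡ independentSets → B ⊆ support × AffinelyIndependent B
    ∈-independentSets⁻ B∈ =
      proj₂ (∈-filter⁻ (λ B → excludedMiddle ℝ {B ⊆ support × AffinelyIndependent B})
                       {xs = subsets size} B∈)

  module _ (P : Polytope) where
    open Polytope P

    -- A largest affinely independent subset of F remains independent when i is adjoined, so P has
    -- an independent set with one more element.
    dim-proper-face : (F : NonemptyFace) → ∀ {i} → i ∈ support → i ∉ proj₁ F →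
                      Polytope.dim ⟨ F ⟩ ℕ.< dim
    dim-proper-face Fₙ@(F , F-face , k , k∈F) {i} i∈ i∉F
      = go (maximum-attained ∣_∣ ⁅k⁆∈)
      where
      ⁅k⁆∈ : ⁅ k ⁆ ∈ˡ independentSets ⟨ Fₙ ⟩
      ⁅k⁆∈ = ∈-independentSets⁺ ⟨ Fₙ ⟩
        (λ l∈ → subst (_∈ F) (sym (Subsetₚ.x∈⁅y⁆⇒x≡y k l∈)) k∈F) (⁅⁆-affinelyIndependent P k)

      max : List (Subset size) → ℕ
      max = foldr _⊔_ 0 ∘ map ∣_∣

      go : ∃[ B ] (B ∈ˡ independentSets ⟨ Fₙ ⟩ × ∣ B ∣ ≡ max (independentSets ⟨ Fₙ ⟩)) →
           Polytope.dim ⟨ Fₙ ⟩ ℕ.< dim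
      go (B , B∈ , ∣B∣≡max) with ∈-independentSets⁻ ⟨ Fₙ ⟩ B∈
      ... | B⊆F , indep = ℕₚ.pred-mono-< {{ℕ.>-nonZero 0<max}}
        (ℕₚ.<-≤-trans (subst (ℕ._< ∣ B ∪ ⁅ i ⁆ ∣) ∣B∣≡max (Subsetₚ.p⊂q⇒∣p∣<∣q∣ B⊂B∪⁅i⁆))
                      (maximum≥ ∣_∣ B∪⁅i⁆∈))
        where
        -- `pred` preserves a strict inequality only above 0, since `pred 0` and `pred 1` agree. The
        -- singleton of a point of F makes the maximum at least 1.
        0<max : 0 ℕ.< max (independentSets ⟨ Fₙ ⟩)
        0<max = subst (ℕ._≤ max (independentSets ⟨ Fₙ ⟩)) (Subsetₚ.∣⁅x⁆∣≡1 k) (maximum≥ ∣_∣ ⁅k⁆∈)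
        i∈⁅i⁆ = Subsetₚ.x∈p∪q⁺ {p = B} (inj₂ (Subsetₚ.x∈⁅x⁆ i))
        B⊂B∪⁅i⁆ : B ⊂ B ∪ ⁅ i ⁆
        B⊂B∪⁅i⁆ = (λ {x} → Subsetₚ.p⊆p∪q ⁅ i ⁆ {x}) , i , i∈⁅i⁆ , λ i∈B → i∉F (B⊆F i∈B)
        B∪⁅i⁆∈ : (B ∪ ⁅ i ⁆) ∈ˡ independentSets P
        B∪⁅i⁆∈ = ∈-independentSets⁺ P
          (λ x∈ → [ (λ x∈B → IsFace⇒⊆ P F-face (B⊆F x∈B))
                  , (λ x∈⁅i⁆ → subst (_∈ support) (sym (Subsetₚ.x∈⁅y⁆⇒x≡y i x∈⁅i⁆)) i∈)
                  ]′ (Subsetₚ.x∈p∪q⁻ B ⁅ i ⁆ x∈))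
          (adjoin-affinelyIndependent P F-face B⊆F i∈ i∉F indep)

    dim-face≡⇒≡support : (F : NonemptyFace) → Polytope.dim ⟨ F ⟩ ≡ dim → proj₁ F ≡ support
    dim-face≡⇒≡support Fₙ@(F , F-face , _) dim≡ =
      Subsetₚ.⊆-antisym (IsFace⇒⊆ P F-face) λ {i} i∈ → case i Subsetₚ.∈? F of λ where
        (yes i∈F) → i∈F
        (no  i∉F) → contradiction dim≡ (ℕₚ.<⇒≢ (dim-proper-face Fₙ i∈ i∉F))

-- The recursion satisfied by f

module _ (ℝ : CompleteOrderedField) where
  open Polytopes ℝ
  open Polytope using (dim; size; support; nonempty; points; faces; IsFace; NonemptyFace; ⟨_⟩)
  open Geometry ℝ
  open ≡-Reasoning

  IsNonemptyFace : (P : Polytope) → Subset (size P) → Set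
  IsNonemptyFace P S = IsFace P S × Nonempty S

  nonemptyFace? : (P : Polytope) (S : Subset (size P)) → Dec (IsNonemptyFace P S)
  nonemptyFace? P S = excludedMiddle ℝ

  -- Extends a function on faces by 0 to all subsets, so that sums over the faces of P and of one of
  -- its faces have a common index set.
  onDec : (P : Polytope) {S : Subset (size P)} →
          (NonemptyFace P → ℤ) → Dec (IsNonemptyFace P S) → ℤ
  onDec P {S} h (yes p) = h (S , p)
  onDec P     h (no _)  = 0ℤ

  ∑-faces : ∀ P h → ∑ (faces P) h ≡ ∑ (subsets (size P)) (λ S → onDec P h (nonemptyFace? P S))
  ∑-faces P h = trans (∑-mapMaybe _ (subsets (size P)) h)
    (∑-cong (subsets (size P)) λ S → lemma S (nonemptyFace? P S))
    where
    lemma : ∀ S (d : Dec (IsNonemptyFace P S)) →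
            maybe′ h 0ℤ (Maybe.map (S ,_) (dec⇒maybe d)) ≡ onDec P h d
    lemma S (yes _) = refl
    lemma S (no _)  = refl

  -- The subsets that are nonempty faces of F are exactly the nonempty faces of P inside F. In
  -- `agree`, p and q are independent because each list of faces carries its own witnesses.
  ∑-faces-of-face : ∀ P (F : NonemptyFace P) h k →
    (∀ G p q → G ⊆ proj₁ F → h (G , p) ≡ k (G , q)) →
    (∀ G → ¬ (proj₁ G ⊆ proj₁ F) → h G ≡ 0ℤ) →
    ∑ (faces P) h ≡ ∑ (faces (⟨_⟩ P F)) k
  ∑-faces-of-face P F h k agree vanish = begin
    ∑ (faces P) h
      ≡⟨ ∑-faces P h ⟩
    ∑ (subsets (size P)) (λ S → onDec P h (nonemptyFace? P S))
      ≡⟨ ∑-cong (subsets (size P)) (λ S → lemma S (nonemptyFace? P S) (nonemptyFace? (⟨_⟩ P F) S)) ⟩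
    ∑ (subsets (size P)) (λ S → onDec (⟨_⟩ P F) k (nonemptyFace? (⟨_⟩ P F) S))
      ≡⟨ ∑-faces (⟨_⟩ P F) k ⟨
    ∑ (faces (⟨_⟩ P F)) k ∎
    where
    lemma : ∀ S (d : Dec (IsNonemptyFace P S)) (d′ : Dec (IsNonemptyFace (⟨_⟩ P F) S)) →
            onDec P h d ≡ onDec (⟨_⟩ P F) k d′
    lemma S (yes p) (yes q) = agree S p q (IsFace⇒⊆ (⟨_⟩ P F) (proj₁ q))
    lemma S (yes p) (no ¬q) = vanish (S , p)
      λ S⊆F → ¬q (face-within⇒face-of-face P F (proj₁ p) S⊆F , proj₂ p)
    lemma S (no ¬p) (yes q) = contradiction (face-of-face⇒face P F (proj₁ q) , proj₂ q) ¬p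
    lemma S (no _)  (no _)  = refl

  ∑-faces-single : ∀ P S (S-face : IsNonemptyFace P S) h z →
    (∀ p → h (S , p) ≡ z) →
    (∀ F → proj₁ F ≢ S → h F ≡ 0ℤ) →
    ∑ (faces P) h ≡ z
  ∑-faces-single P S S-face h z at-S vanish = begin
    ∑ (faces P) h
      ≡⟨ ∑-faces P h ⟩
    ∑ (subsets (size P)) (λ G → onDec P h (nonemptyFace? P G))
      ≡⟨ ∑-single (subsets-unique (size P)) (∈-subsets S) (λ G → off G (nonemptyFace? P G)) ⟩
    onDec P h (nonemptyFace? P S)
      ≡⟨ on-S (nonemptyFace? P S) ⟩
    z ∎
    where
    off : ∀ G (d : Dec (IsNonemptyFace P G)) → G ≢ S → onDec P h d ≡ 0ℤ
    off G (yes p) G≢S = vanish (G , p) G≢S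
    off G (no _)  G≢S = refl
    on-S : (d : Dec (IsNonemptyFace P S)) → onDec P h d ≡ z
    on-S (yes p) = at-S p
    on-S (no ¬p) = contradiction S-face ¬p

  ∑-facesOfDim : ∀ P a h →
    ∑ (facesOfDim P a) h ≡ ∑ (faces P) (λ F → 𝟙 (dim (⟨_⟩ P F) ≟ a) ℤ.* h F)
  ∑-facesOfDim P a h = ∑-filter (λ F → dim (⟨_⟩ P F) ≟ a) (faces P) h

  -- Counting chains by their largest member

  linked-⊇? : (P : Polytope) (Fs : List (NonemptyFace P)) →
              Dec (Linked (λ F G → proj₁ G ⊆ proj₁ F) Fs)
  linked-⊇? P = linked? (λ F G → proj₁ G ⊆? proj₁ F)

  chainCount : Polytope → ∀ {n} → Descending n → ℤ
  chainCount P as = + length (chains P as)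

  -- The ways to continue a chain of P below its member F, still counted among the faces of P.
  chainsBelow : (P : Polytope) → NonemptyFace P → ∀ {n} → Descending n → ℤ
  chainsBelow P F as = ∑ (tuples P as) λ Gs → 𝟙 (linked-⊇? P (F ∷ Gs))

  chainCount-∷′ : ∀ P {n} (a : Fin n) as →
    chainCount P (a ∷ as) ≡ ∑ (facesOfDim P (toℕ a)) λ F → chainsBelow P F as
  chainCount-∷′ P a as =
    trans (+length-filter (linked-⊇? P) (tuples P (a ∷ as)))
          (∑-cartesianProductWith _∷_ (facesOfDim P (toℕ a)) (tuples P as) _)

  chainsBelow-∷ : ∀ P F {n} (a : Fin n) as → chainsBelow P F (a ∷ as) ≡
    ∑ (facesOfDim P (toℕ a)) λ G → 𝟙 (proj₁ G ⊆? proj₁ F) ℤ.* chainsBelow P G as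
  chainsBelow-∷ P F a as =
    trans (∑-cartesianProductWith _∷_ (facesOfDim P (toℕ a)) (tuples P as) _)
          (∑-cong (facesOfDim P (toℕ a)) λ G →
            trans (∑-cong (tuples P as) λ Gs →
                    𝟙-× (linked-⊇? P (F ∷ G ∷ Gs)) (proj₁ G ⊆? proj₁ F) (linked-⊇? P (G ∷ Gs))
                        (λ l → (λ {x} → Linked.head l {x}) , Linked.tail l)
                        (λ G⊆F l → (λ {x} → G⊆F {x}) ∷ l))
                  (sym (*-distribˡ-∑ (𝟙 (proj₁ G ⊆? proj₁ F)) (tuples P as) _)))

  -- The improper face of P is P itself only up to the nonemptiness witness.
  withNonempty : (P : Polytope) → Nonempty (support P) → Polytope
  withNonempty P p = record { points = points P ; support = support P ; nonempty = p }

  -- `facesOfDim` computes to the same list on both sides, but `tuples` is stuck on a variable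
  -- sequence; hence the induction.
  tuples-nonempty-irrelevant : ∀ P p {n} (as : Descending n) → tuples (withNonempty P p) as ≡ tuples P as
  tuples-nonempty-irrelevant P p []       = refl
  tuples-nonempty-irrelevant P p (a ∷ as) =
    cong (cartesianProductWith _∷_ (facesOfDim P (toℕ a))) (tuples-nonempty-irrelevant P p as)

  chainCount-nonempty-irrelevant : ∀ P p {n} (as : Descending n) →
    chainCount (withNonempty P p) as ≡ chainCount P as
  chainCount-nonempty-irrelevant P p as =
    cong (λ ts → + length (filter (linked-⊇? P) ts)) (tuples-nonempty-irrelevant P p as)

  -- Induction on the sequence, for all polytopes at once. For the next member G the hypothesis is
  -- applied in P and again in Q, the polytope F; both give the chain count of the hull of G, up to
  -- the nonemptiness witness.
  chainsBelow≡chainCount : ∀ P F {n} (as : Descending n) →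
    chainsBelow P F as ≡ chainCount (⟨_⟩ P F) as
  chainsBelow≡chainCount P F []       = refl
  chainsBelow≡chainCount P F (a ∷ as) = begin
    chainsBelow P F (a ∷ as)
      ≡⟨ chainsBelow-∷ P F a as ⟩
    ∑ (facesOfDim P (toℕ a)) (λ G → 𝟙 (proj₁ G ⊆? proj₁ F) ℤ.* chainsBelow P G as)
      ≡⟨ ∑-facesOfDim P (toℕ a) _ ⟩
    ∑ (faces P) h
      ≡⟨ ∑-faces-of-face P F h k agree vanish ⟩
    ∑ (faces Q) k
      ≡⟨ ∑-facesOfDim Q (toℕ a) _ ⟨
    ∑ (facesOfDim Q (toℕ a)) (λ G → chainsBelow Q G as)
      ≡⟨ chainCount-∷′ Q a as ⟨
    chainCount Q (a ∷ as) ∎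
    where
    Q = ⟨_⟩ P F
    h : NonemptyFace P → ℤ
    h G = 𝟙 (dim (⟨_⟩ P G) ≟ toℕ a) ℤ.* (𝟙 (proj₁ G ⊆? proj₁ F) ℤ.* chainsBelow P G as)
    k : NonemptyFace Q → ℤ
    k G = 𝟙 (dim (⟨_⟩ Q G) ≟ toℕ a) ℤ.* chainsBelow Q G as

    agree : ∀ G p q → G ⊆ proj₁ F → h (G , p) ≡ k (G , q)
    agree G p q G⊆F = cong (𝟙 (dim (⟨_⟩ P (G , p)) ≟ toℕ a) ℤ.*_) (begin
      𝟙 (G ⊆? proj₁ F) ℤ.* chainsBelow P (G , p) as
        ≡⟨ cong (ℤ._* chainsBelow P (G , p) as) (𝟙-yes (G ⊆? proj₁ F) G⊆F) ⟩
      1ℤ ℤ.* chainsBelow P (G , p) as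
        ≡⟨ ℤₚ.*-identityˡ _ ⟩
      chainsBelow P (G , p) as
        ≡⟨ chainsBelow≡chainCount P (G , p) as ⟩
      chainCount (⟨_⟩ P (G , p)) as
        ≡⟨ chainCount-nonempty-irrelevant (⟨_⟩ Q (G , q)) (proj₂ p) as ⟩
      chainCount (⟨_⟩ Q (G , q)) as
        ≡⟨ chainsBelow≡chainCount Q (G , q) as ⟨
      chainsBelow Q (G , q) as ∎)

    vanish : ∀ G → ¬ (proj₁ G ⊆ proj₁ F) → h G ≡ 0ℤ
    vanish G G⊈F = begin
      h G
        ≡⟨ cong (λ z → 𝟙 (dim (⟨_⟩ P G) ≟ toℕ a) ℤ.* (z ℤ.* chainsBelow P G as))
                (𝟙-no (proj₁ G ⊆? proj₁ F) G⊈F) ⟩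
      𝟙 (dim (⟨_⟩ P G) ≟ toℕ a) ℤ.* (0ℤ ℤ.* chainsBelow P G as)
        ≡⟨ ℤₚ.*-zeroʳ (𝟙 (dim (⟨_⟩ P G) ≟ toℕ a)) ⟩
      0ℤ ∎

  chainCount-∷ : ∀ P {n} (a : Fin n) as →
    chainCount P (a ∷ as) ≡ ∑ (facesOfDim P (toℕ a)) λ F → chainCount (⟨_⟩ P F) as
  chainCount-∷ P a as =
    trans (chainCount-∷′ P a as)
          (∑-cong (facesOfDim P (toℕ a)) λ F → chainsBelow≡chainCount P F as)

  -- Coefficients of the f-polynomial

  module _ (b : ℕ) (e : Exponents) where

    monomial : ∀ {n} → Descending n → ℤ
    monomial as = (α^ lowest as) b ℤ.* M (gaps as) e

    weight : Polytope → ∀ {n} → Descending n → ℤ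
    weight P as = chainCount P as ℤ.* monomial as

    -- The leading term α^n is the weight of the empty sequence, which has one chain and lowest
    -- entry n. With n and m free, a face of dimension x can be summed with the length bound of the
    -- larger polytope.
    ⟦fPolynomial⟧ : ∀ P {m n} → dim P ≡ n → n ℕ.< m →
                    ⟦ fPolynomial P ⟧ b e ≡ ∑descending m n (weight P)
    ⟦fPolynomial⟧ P {m} {n} refl n<m = begin
      ⟦ fPolynomial P ⟧ b e
        ≡⟨ ⟦⟧≡∑ (fPolynomial P) b e ⟩
      weight P {n} [] ℤ.+ ∑ (concatMap (λ k → map term (descending k n)) (map suc (upTo n))) (coefficient b e)
        ≡⟨ cong₂ ℤ._+_ (sym (ℤₚ.+-identityʳ (weight P {n} []))) (begin
             ∑ (concatMap (λ k → map term (descending k n)) (map suc (upTo n))) (coefficient b e)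
               ≡⟨ ∑-concatMap _ (map suc (upTo n)) (coefficient b e) ⟩
             ∑ (map suc (upTo n)) (λ k → ∑ (map term (descending k n)) (coefficient b e))
               ≡⟨ ∑-cong (map suc (upTo n)) (λ k → ∑-map term (descending k n) (coefficient b e)) ⟩
             ∑ (map suc (upTo n)) (λ k → ∑ (descending k n) (weight P))
               ≡⟨ cong (λ l → ∑ l λ k → ∑ (descending k n) (weight P)) (Listₚ.map-upTo suc n) ⟩
             _ ∎) ⟩
      ∑descending (suc n) n (weight P)
        ≡⟨ ∑descending-stable (weight P) ℕₚ.≤-refl n<m ⟩
      ∑descending m n (weight P) ∎
      where
      term : Descending n → ℤ × ℕ × Composition
      term as = + length (chains P as) , lowest as , gaps as

  -- The first gap n - x absorbs the first exponent. What remains, with the same lowest entry, is a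
  -- sequence for the faces of dimension x.
  weight-∷ : ∀ b j e P {n} (x : Fin n) as → weight b (suc j ∷ e) P (x ∷ as) ≡
    𝟙 (suc j ≟ n ∸ toℕ x) ℤ.* ∑ (facesOfDim P (toℕ x)) λ F → weight b e (⟨_⟩ P F) as
  weight-∷ b j e P {n} x as = begin
    chainCount P (x ∷ as) ℤ.* ((α^ lowest as) b ℤ.* M (gaps (x ∷ as)) (suc j ∷ e))
      ≡⟨ cong₂ (λ c m → c ℤ.* ((α^ lowest as) b ℤ.* m)) (chainCount-∷ P x as)
           (M-suc-∷ {p = proj₂ (gaps (x ∷ as))} {proj₂ (gaps as)} j e) ⟩
    c ℤ.* ((α^ lowest as) b ℤ.* (i ℤ.* M (gaps as) e))
      ≡⟨ solve 4 (λ c α i m → c :* (α :* (i :* m)) := i :* (c :* (α :* m))) refl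
           c ((α^ lowest as) b) i (M (gaps as) e) ⟩
    i ℤ.* (c ℤ.* monomial b e as)
      ≡⟨ cong (i ℤ.*_) (*-distribʳ-∑ (monomial b e as) (facesOfDim P (toℕ x)) _) ⟩
    i ℤ.* ∑ (facesOfDim P (toℕ x)) (λ F → weight b e (⟨_⟩ P F) as) ∎
    where
    open +-*-Solver
    i = 𝟙 (suc j ≟ n ∸ toℕ x)
    c = ∑ (facesOfDim P (toℕ x)) λ F → chainCount (⟨_⟩ P F) as

  facesOfCodim : (P : Polytope) → ℕ → List (NonemptyFace P)
  facesOfCodim P k = filter (λ F → dim (⟨_⟩ P F) ℕ.+ k ≟ dim P) (faces P)

  fPolynomial-suc : ∀ P b j e → ⟦ fPolynomial P ⟧ b (suc j ∷ e) ≡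
    ∑ (facesOfCodim P (suc j)) λ F → ⟦ fPolynomial (⟨_⟩ P F) ⟧ b e
  fPolynomial-suc P b j e = begin
    ⟦ fPolynomial P ⟧ b (suc j ∷ e)
      ≡⟨ ⟦fPolynomial⟧ b (suc j ∷ e) P refl ℕₚ.≤-refl ⟩
    ∑descending (suc n) n (weight b (suc j ∷ e) P)
      ≡⟨ ∑descending-suc n n (weight b (suc j ∷ e) P) ⟩
    weight b (suc j ∷ e) P {n} [] ℤ.+ (∑ (allFin n) λ x →
      ∑descending n (toℕ x) (λ as → weight b (suc j ∷ e) P (x ∷ as)))
      ≡⟨ cong₂ ℤ._+_ empty (∑-cong (allFin n) below) ⟩
    0ℤ ℤ.+ (∑ (allFin n) λ x → ∑ (faces P) λ F →
      𝟙 (suc j ≟ n ∸ toℕ x) ℤ.* 𝟙 (dim (⟨_⟩ P F) ≟ toℕ x) ℤ.* value F)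
      ≡⟨ ℤₚ.+-identityˡ _ ⟩
    ∑ (allFin n) (λ x → ∑ (faces P) λ F →
      𝟙 (suc j ≟ n ∸ toℕ x) ℤ.* 𝟙 (dim (⟨_⟩ P F) ≟ toℕ x) ℤ.* value F)
      ≡⟨ ∑-comm (allFin n) (faces P) _ ⟩
    ∑ (faces P) (λ F → ∑ (allFin n) λ x →
      𝟙 (suc j ≟ n ∸ toℕ x) ℤ.* 𝟙 (dim (⟨_⟩ P F) ≟ toℕ x) ℤ.* value F)
      ≡⟨ ∑-cong (faces P) (λ F → sym (*-distribʳ-∑ (value F) (allFin n) _)) ⟩
    ∑ (faces P) (λ F →
      ∑ (allFin n) (λ x → 𝟙 (suc j ≟ n ∸ toℕ x) ℤ.* 𝟙 (dim (⟨_⟩ P F) ≟ toℕ x)) ℤ.* value F)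
      ≡⟨ ∑-cong (faces P) (λ F → cong (ℤ._* value F) (∑-𝟙-codimension n (suc j) (dim (⟨_⟩ P F)))) ⟩
    ∑ (faces P) (λ F → 𝟙 (dim (⟨_⟩ P F) ℕ.+ suc j ≟ n) ℤ.* value F)
      ≡⟨ ∑-filter (λ F → dim (⟨_⟩ P F) ℕ.+ suc j ≟ n) (faces P) value ⟨
    ∑ (facesOfCodim P (suc j)) value ∎
    where
    n = dim P
    value : NonemptyFace P → ℤ
    value F = ⟦ fPolynomial (⟨_⟩ P F) ⟧ b e

    -- The term α^n contains no t-variable, so a positive exponent has coefficient 0 in it.
    empty : weight b (suc j ∷ e) P {n} [] ≡ 0ℤ
    empty = trans (ℤₚ.*-identityˡ _) (ℤₚ.*-zeroʳ ((α^ n) b))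

    below : ∀ x → ∑descending n (toℕ x) (λ as → weight b (suc j ∷ e) P (x ∷ as)) ≡
      ∑ (faces P) λ F → 𝟙 (suc j ≟ n ∸ toℕ x) ℤ.* 𝟙 (dim (⟨_⟩ P F) ≟ toℕ x) ℤ.* value F
    below x = begin
      ∑descending n (toℕ x) (λ as → weight b (suc j ∷ e) P (x ∷ as))
        ≡⟨ ∑descending-cong n (toℕ x) (weight-∷ b j e P x) ⟩
      ∑descending n (toℕ x) (λ as → i ℤ.* ∑ (facesOfDim P (toℕ x)) λ F → weight b e (⟨_⟩ P F) as)
        ≡⟨ *-distribˡ-∑descending i n (toℕ x) _ ⟨
      i ℤ.* ∑descending n (toℕ x) (λ as → ∑ (facesOfDim P (toℕ x)) λ F → weight b e (⟨_⟩ P F) as)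
        ≡⟨ cong (i ℤ.*_) (∑descending-∑ n (toℕ x) (facesOfDim P (toℕ x)) λ F → weight b e (⟨_⟩ P F)) ⟩
      i ℤ.* ∑ (facesOfDim P (toℕ x)) (λ F → ∑descending n (toℕ x) (weight b e (⟨_⟩ P F)))
        ≡⟨ cong (i ℤ.*_) (∑-facesOfDim P (toℕ x) _) ⟩
      i ℤ.* ∑ (faces P) (λ F → 𝟙 (dim (⟨_⟩ P F) ≟ toℕ x) ℤ.* ∑descending n (toℕ x) (weight b e (⟨_⟩ P F)))
        -- Where dim F = x, the length bound n > x captures all of f(F); elsewhere the indicator is
        -- 0.
        ≡⟨ cong (i ℤ.*_) (∑-cong (faces P) λ F → 𝟙-*-cong (dim (⟨_⟩ P F) ≟ toℕ x) λ dim≡ →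
             sym (⟦fPolynomial⟧ b e (⟨_⟩ P F) dim≡ (toℕ<n x))) ⟩
      i ℤ.* ∑ (faces P) (λ F → 𝟙 (dim (⟨_⟩ P F) ≟ toℕ x) ℤ.* value F)
        ≡⟨ *-distribˡ-∑ i (faces P) _ ⟩
      ∑ (faces P) (λ F → i ℤ.* (𝟙 (dim (⟨_⟩ P F) ≟ toℕ x) ℤ.* value F))
        ≡⟨ ∑-cong (faces P) (λ F → sym (ℤₚ.*-assoc i (𝟙 (dim (⟨_⟩ P F) ≟ toℕ x)) (value F))) ⟩
      ∑ (faces P) (λ F → i ℤ.* 𝟙 (dim (⟨_⟩ P F) ≟ toℕ x) ℤ.* value F) ∎
      where i = 𝟙 (suc j ≟ n ∸ toℕ x)

  fPolynomial-nonempty-irrelevant : ∀ P p b e →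
    ⟦ fPolynomial (withNonempty P p) ⟧ b e ≡ ⟦ fPolynomial P ⟧ b e
  fPolynomial-nonempty-irrelevant P p b e = begin
    ⟦ fPolynomial (withNonempty P p) ⟧ b e
      ≡⟨ ⟦fPolynomial⟧ b e (withNonempty P p) refl ℕₚ.≤-refl ⟩
    ∑descending (suc (dim P)) (dim P) (weight b e (withNonempty P p))
      ≡⟨ ∑descending-cong (suc (dim P)) (dim P) (λ as →
           cong (ℤ._* monomial b e as) (chainCount-nonempty-irrelevant P p as)) ⟩
    ∑descending (suc (dim P)) (dim P) (weight b e P)
      ≡⟨ ⟦fPolynomial⟧ b e P refl ℕₚ.≤-refl ⟨
    ⟦ fPolynomial P ⟧ b e ∎

  fPolynomial-zero : ∀ P b e → ⟦ fPolynomial P ⟧ b (0 ∷ e) ≡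
    ∑ (facesOfCodim P 0) λ F → ⟦ fPolynomial (⟨_⟩ P F) ⟧ b e
  fPolynomial-zero P b e = begin
    ⟦ fPolynomial P ⟧ b (0 ∷ e)
      ≡⟨ ⟦⟧≡∑ (fPolynomial P) b (0 ∷ e) ⟩
    -- The filter in `M` drops the leading 0, so the two coefficient functions agree by computation.
    ∑ (fPolynomial P) (coefficient b e)
      ≡⟨ ⟦⟧≡∑ (fPolynomial P) b e ⟨
    ⟦ fPolynomial P ⟧ b e
      ≡⟨ ∑-faces-single P (support P) (support-isFace P , nonempty P) _ _ at-support off-support ⟨
    ∑ (faces P) (λ F → 𝟙 (dim (⟨_⟩ P F) ℕ.+ 0 ≟ dim P) ℤ.* ⟦ fPolynomial (⟨_⟩ P F) ⟧ b e)
      ≡⟨ ∑-filter (λ F → dim (⟨_⟩ P F) ℕ.+ 0 ≟ dim P) (faces P) _ ⟨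
    ∑ (facesOfCodim P 0) (λ F → ⟦ fPolynomial (⟨_⟩ P F) ⟧ b e) ∎
    where
    at-support : ∀ p → 𝟙 (dim (⟨_⟩ P (support P , p)) ℕ.+ 0 ≟ dim P) ℤ.*
      ⟦ fPolynomial (⟨_⟩ P (support P , p)) ⟧ b e ≡ ⟦ fPolynomial P ⟧ b e
    at-support p = trans
      (cong₂ ℤ._*_ (𝟙-yes (dim P ℕ.+ 0 ≟ dim P) (ℕₚ.+-identityʳ (dim P)))
                   (fPolynomial-nonempty-irrelevant P (proj₂ p) b e))
      (ℤₚ.*-identityˡ _)

    off-support : ∀ F → proj₁ F ≢ support P →
      𝟙 (dim (⟨_⟩ P F) ℕ.+ 0 ≟ dim P) ℤ.* ⟦ fPolynomial (⟨_⟩ P F) ⟧ b e ≡ 0ℤ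
    off-support F F≢ =
      cong (ℤ._* ⟦ fPolynomial (⟨_⟩ P F) ⟧ b e) (𝟙-no (dim (⟨_⟩ P F) ℕ.+ 0 ≟ dim P) λ dim≡ →
        F≢ (dim-face≡⇒≡support P F (trans (sym (ℕₚ.+-identityʳ _)) dim≡)))

  fPolynomial-∷ : ∀ P b j e → ⟦ fPolynomial P ⟧ b (j ∷ e) ≡
    ∑ (facesOfCodim P j) λ F → ⟦ fPolynomial (⟨_⟩ P F) ⟧ b e
  fPolynomial-∷ P b zero    e = fPolynomial-zero P b e
  fPolynomial-∷ P b (suc j) e = fPolynomial-suc P b j e

  ⟦f-⨁⟧ : ∀ {A : Set} (g : A → Polytope) xs b e →
    ⟦ f (⨁ (map (λ x → gen (g x)) xs)) ⟧ b e ≡ ∑ xs λ x → ⟦ fPolynomial (g x) ⟧ b e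
  ⟦f-⨁⟧ g []       b e = refl
  ⟦f-⨁⟧ g (x ∷ xs) b e =
    trans (⟦⟧-++ (fPolynomial (g x)) _ b e)
          (cong (λ z → ⟦ fPolynomial (g x) ⟧ b e ℤ.+ z) (⟦f-⨁⟧ g xs b e))

  -- A nonempty sequence has at least one gap, and `M` of a nonempty composition has no constant
  -- term.
  fPolynomial-[] : ∀ P b → ⟦ fPolynomial P ⟧ b [] ≡ (α^ dim P) b
  fPolynomial-[] P b = begin
    ⟦ fPolynomial P ⟧ b []
      ≡⟨ ⟦fPolynomial⟧ b [] P refl ℕₚ.≤-refl ⟩
    ∑descending (suc n) n (weight b [] P)
      ≡⟨ ∑descending-suc n n (weight b [] P) ⟩
    weight b [] P {n} [] ℤ.+ (∑ (allFin n) λ x → ∑descending n (toℕ x) (λ as → weight b [] P (x ∷ as)))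
      ≡⟨ cong₂ ℤ._+_ (trans (ℤₚ.*-identityˡ _) (ℤₚ.*-identityʳ ((α^ n) b)))
           (∑-zero (allFin n) λ x → ∑-zero (upTo n) λ k → ∑-zero (descending k (toℕ x)) λ as →
             trans (cong (chainCount P (x ∷ as) ℤ.*_) (ℤₚ.*-zeroʳ ((α^ lowest as) b)))
                   (ℤₚ.*-zeroʳ (chainCount P (x ∷ as)))) ⟩
    (α^ n) b ℤ.+ 0ℤ
      ≡⟨ ℤₚ.+-identityʳ _ ⟩
    (α^ n) b ∎
    where n = dim P

  -- Extension to all of the polytope ring and comparison with ψ

  open Free _∼_ using (𝟎; _⊕_; ⊖_)

  f-T : ∀ p b j e → T (f p) b j e ≡ (f [t]) (Φ p) b j e
  f-T (gen P) b j e = trans (fPolynomial-∷ P b j e) (sym (⟦f-⨁⟧ (⟨_⟩ P) (facesOfCodim P j) b e))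
  f-T 𝟎       b j e = refl
  f-T (p ⊕ q) b j e =
    trans (⟦⟧-++ (f p) (f q) b (j ∷ e))
          (trans (cong₂ ℤ._+_ (f-T p b j e) (f-T q b j e)) (sym (⟦⟧-++ (f (d j p)) (f (d j q)) b e)))
  f-T (⊖ p)   b j e =
    trans (⟦⟧-negate (f p) b (j ∷ e))
          (trans (cong ℤ.-_ (f-T p b j e)) (sym (⟦⟧-negate (f (d j p)) b e)))

  module _ (ψ : Term → Qsym[α]) (linear : IsLinear ψ)
    (ψ-atZero : ∀ (P : Polytope) a → atZero (ψ (gen P)) a ≡ (α^ Polytope.dim P) a) where
    open IsLinear linear

    atZero≡ : ∀ p a → atZero (ψ p) a ≡ atZero (f p) a
    atZero≡ (gen P) a = trans (ψ-atZero P a) (sym (fPolynomial-[] P a))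
    atZero≡ 𝟎       a = ε-homo a []
    atZero≡ (p ⊕ q) a = trans (homo p q a [])
      (trans (⟦⟧-++ (ψ p) (ψ q) a [])
        (trans (cong₂ ℤ._+_ (atZero≡ p a) (atZero≡ q a)) (sym (⟦⟧-++ (f p) (f q) a []))))
    atZero≡ (⊖ p)   a = trans (⁻¹-homo p a [])
      (trans (⟦⟧-negate (ψ p) a [])
        (trans (cong ℤ.-_ (atZero≡ p a)) (sym (⟦⟧-negate (f p) a []))))

theorem3 : (ℝ : CompleteOrderedField) →
    let open Polytopes ℝ in
    (ψ : Term → Qsym[α]) →
    IsLinear ψ →
    (∀ (P : Polytope) a → atZero (ψ (gen P)) a ≡ (α^ Polytope.dim P) a) →
    (∀ p a j e → T (ψ p) a j e ≡ (ψ [t]) (Φ p) a j e) →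
    ∀ p → ψ p ≈Q f p
theorem3 ℝ ψ linear ψ-atZero ψ-T = go
  where
  open Polytopes ℝ
  go : ∀ p → ψ p ≈Q f p
  go p a []      = atZero≡ ℝ ψ linear ψ-atZero p a
  -- The recursion shortens the exponent list while p changes to `d j p`, so the claim is proved for
  -- all p together.
  go p a (j ∷ e) = trans (ψ-T p a j e) (trans (go (d j p) a e) (sym (f-T ℝ p a j e)))
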